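{- Let $n\geq 4$ and consider all unicyclic graphs on $n$ vertices. The minimum of the core index over this class is attained by the lollipop graph $U_{n,3}^l$ if $n\geq 7$, and by the cycle $C_n$ if $n\leq 5$. For $n=6$ the minimum is attained by both $C_6$ and $U_{6,3}^l$.
   Context: All graphs are finite, simple and undirected. A unicyclic graph is a connected graph with the same number of vertices and edges. The lollipop graph $U_{n,3}^l$ is obtained from a triangle $C_3$ and a path on $n-2$ vertices by identifying one end vertex of the path with a vertex of the triangle. A connected subgraph of a graph $G=(V,E)$ is a graph $(V',E')$ with $\emptyset\neq V'\subseteq V$, $E'\subseteq E$, every edge of $E'$ having both endpoints in $V'$, and $(V',E')$ connected; distinct pairs $(V',E')$ are counted separately. The core index $F(G)$ is the number of connected subgraphs of $G$. -}

module Defs where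

open import Data.Nat using (ℕ; zero; suc; _≡ᵇ_; _<ᵇ_; _≤ᵇ_)
open import Data.Bool using (Bool; true; false; _∧_; _∨_; not; if_then_else_)
open import Data.Bool.Properties using (∨-comm)
open import Data.Fin using (Fin; toℕ)
open import Data.Fin.Properties using (_≟_)
open import Data.Vec using (Vec; []; _∷_; lookup)
open import Data.List using (List; []; _∷_; map; concatMap; allFin; cartesianProduct)
open import Data.Bool.ListAction using (all; any)
open import Data.Product using (_×_; _,_)
open import Relation.Nullary using (yes; no; ⌊_⌋)
open import Relation.Binary.PropositionalEquality using (_≡_; refl; sym; cong₂)
open import Data.Empty using (⊥-elim)

record SimpleGraph (n : ℕ) : Set where
  field
    adj    : Fin n → Fin n → Bool
    symm   : ∀ i j → adj i j ≡ adj j i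
    irrefl : ∀ i → adj i i ≡ false
open SimpleGraph public

allV : {n : ℕ} → (Fin n → Bool) → Bool
allV {n} p = all p (allFin n)

anyV : {n : ℕ} → (Fin n → Bool) → Bool
anyV {n} p = any p (allFin n)

countTrue : {A : Set} → (A → Bool) → List A → ℕ
countTrue p []       = 0
countTrue p (x ∷ xs) = if p x then suc (countTrue p xs) else countTrue p xs

step : {n : ℕ} → (Fin n → Bool) → (Fin n → Fin n → Bool) → (Fin n → Bool) → Fin n → Bool
step V E S v = S v ∨ (V v ∧ anyV (λ u → S u ∧ E u v))

iter : {n : ℕ} → ℕ → (Fin n → Bool) → (Fin n → Fin n → Bool) → (Fin n → Bool) → Fin n → Bool
iter zero    V E S = S
iter (suc k) V E S = step V E (iter k V E S)

single : {n : ℕ} → Fin n → Fin n → Bool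
single u v = ⌊ u ≟ v ⌋

-- (V', E') is connected: every two vertices of V' are joined by a walk
-- in E' through V' (walks of length ≤ n suffice).
connectedB : {n : ℕ} → (Fin n → Bool) → (Fin n → Fin n → Bool) → Bool
connectedB {n} V E =
  allV (λ u → allV (λ v → not (V u ∧ V v) ∨ iter n V E (single u) v))

edgeCount : {n : ℕ} → SimpleGraph n → ℕ
edgeCount {n} G =
  countTrue (λ { (i , j) → (toℕ i <ᵇ toℕ j) ∧ adj G i j })
            (cartesianProduct (allFin n) (allFin n))

Connected : {n : ℕ} → SimpleGraph n → Set
Connected G = connectedB (λ _ → true) (adj G) ≡ true

Unicyclic : {n : ℕ} → SimpleGraph n → Set
Unicyclic {n} G = Connected G × edgeCount G ≡ n

-- Connected subgraphs and the core index
-- A subgraph (V', E') is encoded by the characteristic vector of V' and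
-- the (symmetric) adjacency matrix of E'.  Distinct pairs are distinct
-- encodings, so counting encodings counts pairs (V', E').

vecsOver : {A : Set} → List A → (n : ℕ) → List (Vec A n)
vecsOver xs zero    = [] ∷ []
vecsOver xs (suc n) = concatMap (λ x → map (x ∷_) (vecsOver xs n)) xs

allSubsets : (n : ℕ) → List (Vec Bool n)
allSubsets n = vecsOver (true ∷ false ∷ []) n

allMatrices : (n : ℕ) → List (Vec (Vec Bool n) n)
allMatrices n = vecsOver (allSubsets n) n

isConnectedSubgraph : {n : ℕ} → SimpleGraph n → Vec Bool n → Vec (Vec Bool n) n → Bool
isConnectedSubgraph G V E =
  let Vf = lookup V
      Ef = λ i j → lookup (lookup E i) j
  in anyV Vf
     ∧ allV (λ i → allV (λ j →
          (not (Ef i j) ∨ (adj G i j ∧ Vf i ∧ Vf j))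
          ∧ not (Ef i j ∧ not (Ef j i))))
     ∧ connectedB Vf Ef

coreIndex : {n : ℕ} → SimpleGraph n → ℕ
coreIndex {n} G =
  countTrue (λ { (V , E) → isConnectedSubgraph G V E })
            (cartesianProduct (allSubsets n) (allMatrices n))

private
  ≟-sym : {n : ℕ} (i j : Fin n) → ⌊ i ≟ j ⌋ ≡ ⌊ j ≟ i ⌋
  ≟-sym i j with i ≟ j | j ≟ i
  ... | yes _ | yes _ = refl
  ... | no  _ | no  _ = refl
  ... | yes p | no ¬q = ⊥-elim (¬q (sym p))
  ... | no ¬p | yes q = ⊥-elim (¬p (sym q))

mkGraph : {n : ℕ} → (Fin n → Fin n → Bool) → SimpleGraph n
mkGraph b = record
  { adj    = λ i j → not ⌊ i ≟ j ⌋ ∧ (b i j ∨ b j i)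
  ; symm   = λ i j → cong₂ (λ x y → not x ∧ y) (≟-sym i j) (∨-comm (b i j) (b j i))
  ; irrefl = irr
  }
  where
  irr : ∀ i → (not ⌊ i ≟ i ⌋ ∧ (b i i ∨ b i i)) ≡ false
  irr i with i ≟ i
  ... | yes _ = refl
  ... | no ¬p = ⊥-elim (¬p refl)

cycleGraph : (n : ℕ) → SimpleGraph n
cycleGraph n = mkGraph (λ i j → (suc (toℕ i) ≡ᵇ toℕ j) ∨ ((toℕ i ≡ᵇ 0) ∧ (suc (toℕ j) ≡ᵇ n)))

lollipop : (n : ℕ) → SimpleGraph n
lollipop n = mkGraph (λ i j → ((toℕ i <ᵇ 3) ∧ (toℕ j <ᵇ 3))
                              ∨ ((2 ≤ᵇ toℕ i) ∧ (suc (toℕ i) ≡ᵇ toℕ j)))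

{-# OPTIONS --safe #-}
-- A unicyclic graph consists of a cycle, of length c say, to which the other n − c vertices are attached as leaves,
-- one after another.  If a graph has a connected subgraphs, at least b of them through each vertex, then a new leaf v
-- at w adds {v} and the subgraphs X + wv with w ∈ X, that is b + 1 subgraphs, and each vertex gains at least one
-- (for instance the whole graph); so (a , b) becomes at least (a + b + 1 , b + 1).  The cycle has a = c² + 1 and
-- b = 1 + c(c + 1)/2, and the resulting bound is at least the one for c = 3 unless c = n ≤ 5.  In the lollipop the new
-- leaf is always attached to the previous one, so that b only counts subgraphs through that leaf and there is
-- equality.  For the upper bounds, a list that contains all vertices and is closed under adding an edge at one
-- of its endpoints contains all connected subgraphs.
module Submission where

open import Defs
open import Data.Bool using (Bool; true; false; T; _∧_; _∨_; not; if_then_else_)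
open import Data.Bool.ListAction using (all)
open import Data.Bool.Properties using (T-≡; T-∧; T-∨; T?)
import Data.Bool.Properties as Bool
open import Data.Empty using (⊥; ⊥-elim)
open import Data.Fin using (Fin; zero; suc; toℕ; fromℕ; fromℕ<; inject₁)
open import Data.Fin.Induction using (<-weakInduction)
open import Data.Fin.Properties using (_≟_; all?; any?; ¬∀⟶∃¬; toℕ-injective; toℕ-inject₁; toℕ-fromℕ; toℕ-fromℕ<; toℕ<n)
import Data.Fin.Properties as Fin
open import Data.List using (List; []; _∷_; _++_; length; map; filter; foldr; allFin; concatMap; cartesianProduct; cartesianProductWith)
open import Data.List.Membership.Propositional using (_∈_; _∉_; find; lose)
open import Data.List.Membership.Propositional.Properties
import Data.List.Relation.Binary.Permutation.Setoid.Properties as Perm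
open import Data.List.Properties using (length-tabulate; length-++; length-map)
open import Data.List.Relation.Binary.Subset.Propositional using (_⊆_)
open import Data.List.Relation.Unary.All as All using (All; []; _∷_)
open import Data.List.Relation.Unary.All.Properties using (all⁺; all⁻; ¬Any⇒All¬; All¬⇒¬Any)
open import Data.List.Relation.Unary.AllPairs using ([]; _∷_)
open import Data.List.Relation.Unary.Any as Any using (Any; here; there)
open import Data.List.Relation.Unary.Any.Properties using (any⁺; any⁻)
open import Data.List.Relation.Unary.Unique.Propositional using (Unique)
import Data.List.Relation.Unary.Unique.Propositional.Properties as Uniq
open import Data.Nat using (ℕ; zero; suc; pred; _+_; _∸_; _≤_; _<_; z≤n; s≤s; s≤s⁻¹; _<ᵇ_; _≤ᵇ_; _≡ᵇ_)
open import Data.Nat.DivMod using (_mod_)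
open import Data.Nat.Properties hiding (_≟_)
open import Data.Nat.Solver using (module +-*-Solver)
open import Data.Product using (∃; ∃₂; _×_; _,_; proj₁; proj₂; swap)
import Data.Product.Properties as Product
open import Data.Sum using (_⊎_; inj₁; inj₂; [_,_]′)
open import Data.Unit using (⊤; tt)
open import Data.Vec using (Vec; []; _∷_; lookup; replicate; tabulate)
open import Data.Vec.Properties using (lookup∘tabulate; tabulate∘lookup; tabulate-cong; ∷-injective)
import Data.Vec.Properties as Vecₚ
open import Function using (_∘_; id; Equivalence)
open import Relation.Binary using (DecidableEquality)
open import Relation.Binary.Construct.Closure.ReflexiveTransitive as Star using (Star; ε; _◅_; _◅◅_)
open import Relation.Binary.PropositionalEquality
open import Relation.Nullary using (¬_; Dec; yes; no; ⌊_⌋; contradiction)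
open import Relation.Nullary.Decidable using (toWitness; fromWitness; decidable-stable; _×-dec_; _⊎-dec_; ¬?)

open Equivalence using (to; from)

-- Counting by lists without repetition

-- `coreIndex` ranges over all 2^(n+n²) pairs of a bit vector and a bit matrix, which is 2^42 for n
-- = 6, so it is bounded and never evaluated. Both bounds go through the inductive predicate
-- `Grown`: a repetition-free list of grown subgraphs bounds the index from below, a list that
-- contains every grown subgraph bounds it from above.
--
-- The comparison of the bounds works because (a , b) ↦ (a + b + 1 , b + 1) is monotone in both
-- entries: it suffices to find one order at which the pair of the other graph dominates that of the
-- lollipop. The pairs of C₄ and C₅ are (17 , 11) and (26 , 16), against (18 , 8) and (27 , 9) for
-- the lollipops of these orders. The cycles are smaller by one in total but have far more subgraphs
-- through a vertex, so that one leaf already puts them ahead. From length 6 on the cycle itself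
-- dominates, with the tie 6² + 1 = 37 = 10 + 8 + 9 + 10.

Unique⇒length-mono : {A : Set} {xs ys : List A} → Unique xs → xs ⊆ ys → length xs ≤ length ys
Unique⇒length-mono {xs = []} _ _ = z≤n
Unique⇒length-mono {xs = x ∷ xs} (x∉ ∷ u) s with ∈-∃++ (s (here refl))
... | as , bs , refl = ≤-trans (s≤s (Unique⇒length-mono u sub)) (≤-reflexive (sym (length-insert as)))
  where
  length-insert : ∀ as → length (as ++ x ∷ bs) ≡ suc (length (as ++ bs))
  length-insert []       = refl
  length-insert (_ ∷ as) = cong suc (length-insert as)
  sub : xs ⊆ as ++ bs
  sub {y} y∈ with ∈-++⁻ as (s (there y∈))
  ... | inj₁ p            = ∈-++⁺ˡ p
  ... | inj₂ (here refl)  = contradiction refl (All.lookup x∉ y∈)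
  ... | inj₂ (there p)    = ∈-++⁺ʳ as p

Unique⇒length≤ : ∀ {n} {xs : List (Fin n)} → Unique xs → length xs ≤ n
Unique⇒length≤ {n} u = ≤-trans (Unique⇒length-mono u (λ {x} _ → ∈-allFin x)) (≤-reflexive (length-tabulate {n = n} id))

Unique-map : {A B : Set} {f : A → B} {xs : List A} →
             (∀ {x y} → x ∈ xs → y ∈ xs → f x ≡ f y → x ≡ y) → Unique xs → Unique (map f xs)
Unique-map {xs = []} _ [] = []
Unique-map {f = f} {xs = x ∷ xs} inj (x∉ ∷ u) =
  All.tabulate fresh ∷ Unique-map (λ p q → inj (there p) (there q)) u
  where
  fresh : ∀ {y} → y ∈ map f xs → f x ≢ y
  fresh y∈ eq with ∈-map⁻ f y∈
  ... | z , z∈ , refl = All.lookup x∉ z∈ (inj (here refl) (there z∈) eq)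

countTrue≡length-filter : {A : Set} (p : A → Bool) (xs : List A) → countTrue p xs ≡ length (filter (T? ∘ p) xs)
countTrue≡length-filter p [] = refl
countTrue≡length-filter p (x ∷ xs) with p x
... | true  = cong suc (countTrue≡length-filter p xs)
... | false = countTrue≡length-filter p xs

countTrue-≤ : {A : Set} {p : A → Bool} {xs ys : List A} → Unique xs →
              (∀ {x} → x ∈ xs → T (p x) → x ∈ ys) → countTrue p xs ≤ length ys
countTrue-≤ {p = p} {xs} u s = subst (_≤ _) (sym (countTrue≡length-filter p xs))
  (Unique⇒length-mono (Uniq.filter⁺ (T? ∘ p) u)
    (λ x∈ → let q , r = ∈-filter⁻ (T? ∘ p) {xs = xs} x∈ in s q r))

countTrue-≥ : {A : Set} {p : A → Bool} {xs ys : List A} → Unique ys →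
              (∀ {y} → y ∈ ys → y ∈ xs × T (p y)) → length ys ≤ countTrue p xs
countTrue-≥ {p = p} {xs} u s = subst (_ ≤_) (sym (countTrue≡length-filter p xs))
  (Unique⇒length-mono u (λ y∈ → let q , r = s y∈ in ∈-filter⁺ (T? ∘ p) q r))

vecsOver-suc : {A : Set} (xs ys : List A) (n : ℕ) →
  concatMap (λ x → map (x ∷_) (vecsOver ys n)) xs ≡ cartesianProductWith _∷_ xs (vecsOver ys n)
vecsOver-suc []       ys n = refl
vecsOver-suc (x ∷ xs) ys n = cong (map (x ∷_) (vecsOver ys n) ++_) (vecsOver-suc xs ys n)

vecsOver-unique : {A : Set} {xs : List A} → Unique xs → ∀ n → Unique (vecsOver xs n)
vecsOver-unique u zero    = [] ∷ []
vecsOver-unique {xs = xs} u (suc n) = subst Unique (sym (vecsOver-suc xs xs n))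
  (Uniq.cartesianProductWith⁺ _∷_ ∷-injective u (vecsOver-unique u n))

∈-vecsOver : {A : Set} {xs : List A} → (∀ x → x ∈ xs) → ∀ {n} (v : Vec A n) → v ∈ vecsOver xs n
∈-vecsOver h [] = here refl
∈-vecsOver {xs = xs} h {suc n} (x ∷ v) = subst ((x ∷ v) ∈_) (sym (vecsOver-suc xs xs n))
  (∈-cartesianProductWith⁺ _∷_ (h x) (∈-vecsOver h v))

-- Walks

data Walk {A : Set} (R : A → A → Set) : A → List A → A → Set where
  []  : ∀ {x} → Walk R x [] x
  _∷_ : ∀ {x y ys z} → R x y → Walk R y ys z → Walk R x (y ∷ ys) z

module _ {A : Set} {R : A → A → Set} where

  Walk-suffix : ∀ {x y ys z} → Walk R y ys z → Unique (y ∷ ys) → x ∈ y ∷ ys →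
                ∃ λ zs → Walk R x zs z × Unique (x ∷ zs)
  Walk-suffix w       u       (here refl) = _ , w , u
  Walk-suffix (_ ∷ w) (_ ∷ u) (there x∈)  = Walk-suffix w u x∈

  -- Loop erasure: if `x` recurs on the simple walk already found for the rest, only the part from
  -- that recurrence on is kept. Simple walks serve to bound the iteration count in `connectedB` and
  -- to obtain cycles without repeated vertices.
  Star⇒simpleWalk : DecidableEquality A → ∀ {x z} → Star R x z →
                    ∃ λ ys → Walk R x ys z × Unique (x ∷ ys)
  Star⇒simpleWalk _≟ᴬ_ ε = [] , [] , [] ∷ []
  Star⇒simpleWalk _≟ᴬ_ {x} (_◅_ {j = y} r s) with Star⇒simpleWalk _≟ᴬ_ s
  ... | ys , w , u with Any.any? (x ≟ᴬ_) (y ∷ ys)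
  ...   | yes x∈ = Walk-suffix w u x∈
  ...   | no  x∉ = _ , r ∷ w , ¬Any⇒All¬ _ x∉ ∷ u

  Walk-++ : ∀ {x xs y ys z} → Walk R x xs y → Walk R y ys z → Walk R x (xs ++ ys) z
  Walk-++ []      v = v
  Walk-++ (r ∷ w) v = r ∷ Walk-++ w v

  Walk-map : ∀ {Q : A → A → Set} → (∀ {x y} → R x y → Q x y) → ∀ {x ys z} → Walk R x ys z → Walk Q x ys z
  Walk-map f []      = []
  Walk-map f (r ∷ w) = f r ∷ Walk-map f w

  end∈ : ∀ {x ys z} → Walk R x ys z → z ∈ x ∷ ys
  end∈ []      = here refl
  end∈ (_ ∷ w) = there (end∈ w)

-- Connectivity

allV⁺ : ∀ {n} {p : Fin n → Bool} → (∀ i → T (p i)) → T (allV p)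
allV⁺ h = all⁻ _ (All.tabulate {xs = allFin _} (λ {i} _ → h i))

allV⁻ : ∀ {n} {p : Fin n → Bool} → T (allV p) → ∀ i → T (p i)
allV⁻ {n} {p} h i = All.lookup (all⁺ p (allFin n) h) (∈-allFin i)

anyV⁺ : ∀ {n} {p : Fin n → Bool} i → T (p i) → T (anyV p)
anyV⁺ {p = p} i h = any⁺ p (lose (∈-allFin i) h)

anyV⁻ : ∀ {n} {p : Fin n → Bool} → T (anyV p) → ∃ λ i → T (p i)
anyV⁻ {n} {p} h with find (any⁻ p (allFin n) h)
... | i , _ , q = i , q

⇒⁺ : ∀ {a b} → (T a → T b) → T (not a ∨ b)
⇒⁺ {true}  f = f _
⇒⁺ {false} f = _

⇒⁻ : ∀ {a b} → T (not a ∨ b) → T a → T b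
⇒⁻ {true} f _ = f

Reach : ∀ {n} → (Fin n → Bool) → (Fin n → Fin n → Bool) → Fin n → Fin n → Set
Reach V E x y = T (V y) × T (E x y)

module _ {n} {V : Fin n → Bool} {E : Fin n → Fin n → Bool} where

  iter-mono : ∀ {S v} j {k} → T (iter k V E S v) → T (iter (j + k) V E S v)
  iter-mono zero    h = h
  iter-mono (suc j) h = from T-∨ (inj₁ (iter-mono j h))

  Walk⇒iter : ∀ {S x ys z} → Walk (Reach V E) x ys z → ∀ k →
              T (iter k V E S x) → T (iter (length ys + k) V E S z)
  Walk⇒iter []                                   k h = h
  Walk⇒iter {S} {x} {_ ∷ ys} {z} ((v , e) ∷ w) k h =
    subst (λ j → T (iter j V E S z)) (+-suc (length ys) k)
      (Walk⇒iter w (suc k) (from T-∨ (inj₂ (from T-∧ (v , anyV⁺ x (from T-∧ (h , e)))))))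

  iter⇒Star : ∀ {u} k {v} → T (iter k V E (single u) v) → Star (Reach V E) u v
  iter⇒Star zero h with refl ← toWitness h = ε
  iter⇒Star {u} (suc k) {v} h with to (T-∨ {iter k V E (single u) v}) h
  ... | inj₁ p = iter⇒Star k p
  ... | inj₂ p = let Vv , q = to (T-∧ {V v}) p
                     x , r  = anyV⁻ q
                     Sx , e = to (T-∧ {iter k V E (single u) x}) r
                 in iter⇒Star k Sx ◅◅ ((Vv , e) ◅ ε)

  connectedB⁺ : (∀ u v → T (V u) → T (V v) → Star (Reach V E) u v) → T (connectedB V E)
  connectedB⁺ h = allV⁺ λ u → allV⁺ λ v → ⇒⁺ λ Vuv → joined u v (to (T-∧ {V u}) Vuv)
    where
    joined : ∀ u v → T (V u) × T (V v) → T (iter n V E (single u) v)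
    joined u v (Vu , Vv) with Star⇒simpleWalk _≟_ (h u v Vu Vv)
    -- A simple walk has at most n steps and the iterates only grow, so the walk is padded to
    -- exactly the n rounds that `connectedB` performs.
    ... | ys , w , uq = subst (λ j → T (iter j V E (single u) v)) (m∸n+n≡m len)
            (iter-mono {single u} (n ∸ length ys)
              (subst (λ j → T (iter j V E (single u) v)) (+-identityʳ (length ys))
                (Walk⇒iter {single u} w 0 (fromWitness {a? = u ≟ u} refl))))
      where
      len : length ys ≤ n
      len = ≤-trans (n≤1+n _) (Unique⇒length≤ uq)

  connectedB⁻ : T (connectedB V E) → ∀ u v → T (V u) → T (V v) → Star (Reach V E) u v
  connectedB⁻ h u v Vu Vv = iter⇒Star n (⇒⁻ (allV⁻ (allV⁻ h u) v) (from T-∧ (Vu , Vv)))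

-- Subgraphs

Sub : ℕ → Set
Sub n = Vec Bool n × Vec (Vec Bool n) n

hasV : ∀ {n} → Sub n → Fin n → Bool
hasV X x = lookup (proj₁ X) x

hasE : ∀ {n} → Sub n → Fin n → Fin n → Bool
hasE X x y = lookup (lookup (proj₂ X) x) y

infix 4 _∈ᵥ_ _∈ₑ_ _⊑_

-- Wrapped in records so that the vertex and the subgraph can be inferred.
record _∈ᵥ_ {n} (x : Fin n) (X : Sub n) : Set where
  constructor mkᵥ
  field bitᵥ : T (hasV X x)

record _∈ₑ_ {n} (e : Fin n × Fin n) (X : Sub n) : Set where
  constructor mkₑ
  field bitₑ : T (hasE X (proj₁ e) (proj₂ e))

open _∈ᵥ_ public
open _∈ₑ_ public

_∈ᵥ?_ : ∀ {n} (x : Fin n) (X : Sub n) → Dec (x ∈ᵥ X)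
x ∈ᵥ? X with T? (hasV X x)
... | yes p = yes (mkᵥ p)
... | no ¬p = no (¬p ∘ bitᵥ)

record _⊑_ {n} (X Y : Sub n) : Set where
  constructor _,_
  field
    ⊑ᵥ : ∀ {x} → x ∈ᵥ X → x ∈ᵥ Y
    ⊑ₑ : ∀ {e} → e ∈ₑ X → e ∈ₑ Y

open _⊑_ public

⊑-refl : ∀ {n} {X : Sub n} → X ⊑ X
⊑-refl = id , id

⊑-trans : ∀ {n} {X Y Z : Sub n} → X ⊑ Y → Y ⊑ Z → X ⊑ Z
⊑-trans (v , e) (v′ , e′) = v′ ∘ v , e′ ∘ e

T-antisym : ∀ {a b} → (T a → T b) → (T b → T a) → a ≡ b
T-antisym {true}  {true}  f g = refl
T-antisym {true}  {false} f g = ⊥-elim (f _)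
T-antisym {false} {true}  f g = ⊥-elim (g _)
T-antisym {false} {false} f g = refl

lookup-ext : {A : Set} {n : ℕ} {v w : Vec A n} → (∀ i → lookup v i ≡ lookup w i) → v ≡ w
lookup-ext {v = v} {w} h = trans (sym (tabulate∘lookup v)) (trans (tabulate-cong h) (tabulate∘lookup w))

⊑-antisym : ∀ {n} {X Y : Sub n} → X ⊑ Y → Y ⊑ X → X ≡ Y
⊑-antisym {n} {X} {Y} (v , e) (v′ , e′) = cong₂ _,_
  (lookup-ext λ x → T-antisym (bitᵥ ∘ v ∘ mkᵥ {x = x} {X}) (bitᵥ ∘ v′ ∘ mkᵥ {x = x} {Y}))
  (lookup-ext λ x → lookup-ext λ y →
    T-antisym (bitₑ ∘ e ∘ mkₑ {e = x , y} {X}) (bitₑ ∘ e′ ∘ mkₑ {e = x , y} {Y}))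

mkSub : ∀ {n} → (Fin n → Bool) → (Fin n → Fin n → Bool) → Sub n
mkSub V E = tabulate V , tabulate (λ x → tabulate (E x))

hasV-mkSub : ∀ {n} V (E : Fin n → Fin n → Bool) x → hasV (mkSub V E) x ≡ V x
hasV-mkSub V E = lookup∘tabulate V

hasE-mkSub : ∀ {n} V (E : Fin n → Fin n → Bool) x y → hasE (mkSub V E) x y ≡ E x y
hasE-mkSub V E x y = trans (cong (λ r → lookup r y) (lookup∘tabulate (λ x → tabulate (E x)) x)) (lookup∘tabulate (E x) y)

-- Single vertices, and adding an edge together with its ends

infixl 6 _⊕_

-- Opaque, so that the arguments can be inferred.
opaque

  vertex : ∀ {n} → Fin n → Sub n
  vertex v = mkSub (single v) (λ _ _ → false)

  _⊕_ : ∀ {n} → Sub n → Fin n × Fin n → Sub n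
  X ⊕ (u , v) = mkSub
    (λ x → hasV X x ∨ (single u x ∨ single v x))
    (λ x y → hasE X x y ∨ ((single u x ∧ single v y) ∨ (single v x ∧ single u y)))

opaque
  unfolding vertex _⊕_

  hasV-vertex : ∀ {n} (v x : Fin n) → hasV (vertex v) x ≡ single v x
  hasV-vertex v x = hasV-mkSub (single v) (λ _ _ → false) x

  hasE-vertex : ∀ {n} (v x y : Fin n) → hasE (vertex v) x y ≡ false
  hasE-vertex v x y = hasE-mkSub (single v) (λ _ _ → false) x y

  hasV-⊕ : ∀ {n} (X : Sub n) u v x → hasV (X ⊕ (u , v)) x ≡ hasV X x ∨ (single u x ∨ single v x)
  hasV-⊕ X u v x = hasV-mkSub _ (λ x y → hasE X x y ∨ ((single u x ∧ single v y) ∨ (single v x ∧ single u y))) x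

  hasE-⊕ : ∀ {n} (X : Sub n) u v x y →
           hasE (X ⊕ (u , v)) x y ≡ hasE X x y ∨ ((single u x ∧ single v y) ∨ (single v x ∧ single u y))
  hasE-⊕ X u v x y = hasE-mkSub (λ x → hasV X x ∨ (single u x ∨ single v x)) _ x y

module _ {n : ℕ} where

  single⁺ : ∀ {x : Fin n} → T (single x x)
  single⁺ = fromWitness refl

  single⁻ : ∀ {x y : Fin n} → T (single x y) → x ≡ y
  single⁻ = toWitness

  ∈ᵥ-vertex⁺ : ∀ {v : Fin n} → v ∈ᵥ vertex v
  ∈ᵥ-vertex⁺ {v} = mkᵥ (subst T (sym (hasV-vertex v v)) single⁺)

  ∈ᵥ-vertex⁻ : ∀ {v x : Fin n} → x ∈ᵥ vertex v → x ≡ v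
  ∈ᵥ-vertex⁻ {v} {x} (mkᵥ p) = sym (single⁻ (subst T (hasV-vertex v x) p))

  ∉ₑ-vertex : ∀ {v : Fin n} {e} → ¬ e ∈ₑ vertex v
  ∉ₑ-vertex {v} {x , y} (mkₑ p) = subst T (hasE-vertex v x y) p

  module _ {X : Sub n} {u v : Fin n} where

    ∈ᵥ-⊕⁻ : ∀ {x} → x ∈ᵥ X ⊕ (u , v) → x ∈ᵥ X ⊎ x ≡ u ⊎ x ≡ v
    ∈ᵥ-⊕⁻ {x} (mkᵥ p) with to (T-∨ {hasV X x}) (subst T (hasV-⊕ X u v x) p)
    ... | inj₁ q = inj₁ (mkᵥ q)
    ... | inj₂ q with to (T-∨ {single u x}) q
    ...   | inj₁ r = inj₂ (inj₁ (sym (single⁻ r)))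
    ...   | inj₂ r = inj₂ (inj₂ (sym (single⁻ r)))

    ∈ₑ-⊕⁻ : ∀ {e} → e ∈ₑ X ⊕ (u , v) → e ∈ₑ X ⊎ e ≡ (u , v) ⊎ e ≡ (v , u)
    ∈ₑ-⊕⁻ {x , y} (mkₑ p) with to (T-∨ {hasE X x y}) (subst T (hasE-⊕ X u v x y) p)
    ... | inj₁ q = inj₁ (mkₑ q)
    ... | inj₂ q with to (T-∨ {single u x ∧ single v y}) q
    ...   | inj₁ r = let a , b = to (T-∧ {single u x}) r in inj₂ (inj₁ (sym (cong₂ _,_ (single⁻ a) (single⁻ b))))
    ...   | inj₂ r = let a , b = to (T-∧ {single v x}) r in inj₂ (inj₂ (sym (cong₂ _,_ (single⁻ a) (single⁻ b))))

    ⊑-⊕ : X ⊑ X ⊕ (u , v)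
    ⊑ᵥ ⊑-⊕ {x} (mkᵥ p) = mkᵥ (subst T (sym (hasV-⊕ X u v x)) (from T-∨ (inj₁ p)))
    ⊑ₑ ⊑-⊕ {x , y} (mkₑ p) = mkₑ (subst T (sym (hasE-⊕ X u v x y)) (from T-∨ (inj₁ p)))

    ⊕ᵥˡ : u ∈ᵥ X ⊕ (u , v)
    ⊕ᵥˡ = mkᵥ (subst T (sym (hasV-⊕ X u v u)) (from (T-∨ {hasV X u}) (inj₂ (from (T-∨ {single u u}) (inj₁ (single⁺ {u}))))))

    ⊕ᵥʳ : v ∈ᵥ X ⊕ (u , v)
    ⊕ᵥʳ = mkᵥ (subst T (sym (hasV-⊕ X u v v))
      (from (T-∨ {hasV X v}) (inj₂ (from (T-∨ {single u v}) (inj₂ single⁺)))))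

    ⊕ₑ : (u , v) ∈ₑ X ⊕ (u , v)
    ⊕ₑ = mkₑ (subst T (sym (hasE-⊕ X u v u v))
      (from (T-∨ {hasE X u v}) (inj₂ (from (T-∨ {single u u ∧ single v v}) (inj₁ (from (T-∧ {single u u}) (single⁺ {u} , single⁺ {v})))))))

    ⊕ₑ-swap : (v , u) ∈ₑ X ⊕ (u , v)
    ⊕ₑ-swap = mkₑ (subst T (sym (hasE-⊕ X u v v u))
      (from (T-∨ {hasE X v u}) (inj₂ (from (T-∨ {single u v ∧ single v u}) (inj₂ (from (T-∧ {single v v}) (single⁺ {v} , single⁺ {u})))))))

  record HasEdge (e : Fin n × Fin n) (Z : Sub n) : Set where
    constructor hasEdge
    field
      src∈ : proj₁ e ∈ᵥ Z
      tgt∈ : proj₂ e ∈ᵥ Z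
      fwd∈ : e ∈ₑ Z
      bwd∈ : swap e ∈ₑ Z

  HasEdge-⊕ : ∀ {X e} → HasEdge e (X ⊕ e)
  HasEdge-⊕ = hasEdge ⊕ᵥˡ ⊕ᵥʳ ⊕ₑ ⊕ₑ-swap

  HasEdge-mono : ∀ {X Y e} → X ⊑ Y → HasEdge e X → HasEdge e Y
  HasEdge-mono (v , e) (hasEdge a b c d) = hasEdge (v a) (v b) (e c) (e d)

  HasEdge-swap : ∀ {X e} → HasEdge e X → HasEdge (swap e) X
  HasEdge-swap (hasEdge a b c d) = hasEdge b a d c

  -- With `⊑-⊕` and `HasEdge-⊕` this characterises `X ⊕ e` by a universal property. The identities
  -- below (order of edges, repetition, orientation) then follow by antisymmetry, without looking at
  -- bits.
  ⊕-least : ∀ {X e Z} → X ⊑ Z → HasEdge e Z → X ⊕ e ⊑ Z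
  ⊕-least {X} {e} (v , f) (hasEdge a b c d) = mV , mE
    where
    mV : ∀ {x} → x ∈ᵥ X ⊕ e → x ∈ᵥ _
    mV p with ∈ᵥ-⊕⁻ p
    ... | inj₁ q           = v q
    ... | inj₂ (inj₁ refl) = a
    ... | inj₂ (inj₂ refl) = b
    mE : ∀ {x} → x ∈ₑ X ⊕ e → x ∈ₑ _
    mE p with ∈ₑ-⊕⁻ p
    ... | inj₁ q           = f q
    ... | inj₂ (inj₁ refl) = c
    ... | inj₂ (inj₂ refl) = d

  ⊕-comm : ∀ {X : Sub n} {e f} → X ⊕ e ⊕ f ≡ X ⊕ f ⊕ e
  ⊕-comm {X} {e} {f} = ⊑-antisym le le
    where
    le : ∀ {e f} → X ⊕ e ⊕ f ⊑ X ⊕ f ⊕ e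
    le = ⊕-least (⊕-least (⊑-trans ⊑-⊕ ⊑-⊕) HasEdge-⊕) (HasEdge-mono ⊑-⊕ HasEdge-⊕)

  ⊕-absorb : ∀ {X : Sub n} {e} → HasEdge e X → X ⊕ e ≡ X
  ⊕-absorb h = ⊑-antisym (⊕-least ⊑-refl h) ⊑-⊕

  ⊕-swap : ∀ {X : Sub n} {e} → X ⊕ e ≡ X ⊕ swap e
  ⊕-swap = ⊑-antisym (⊕-least ⊑-⊕ (HasEdge-swap HasEdge-⊕)) (⊕-least ⊑-⊕ (HasEdge-swap HasEdge-⊕))

  vertex-⊑ : ∀ {v : Fin n} {Z} → v ∈ᵥ Z → vertex v ⊑ Z
  vertex-⊑ v∈ = (λ p → subst (_∈ᵥ _) (sym (∈ᵥ-vertex⁻ p)) v∈) , (λ p → ⊥-elim (∉ₑ-vertex p))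

  vertex-⊕-swap : ∀ {u v : Fin n} → vertex u ⊕ (u , v) ≡ vertex v ⊕ (v , u)
  vertex-⊕-swap = ⊑-antisym le le
    where
    le : ∀ {u v : Fin n} → vertex u ⊕ (u , v) ⊑ vertex v ⊕ (v , u)
    le = ⊕-least (vertex-⊑ ⊕ᵥʳ) (HasEdge-swap HasEdge-⊕)

-- Connected subgraphs grow one edge at a time

Adj : ∀ {n} → SimpleGraph n → Fin n → Fin n → Set
Adj G x y = T (adj G x y)

Adj-sym : ∀ {n} (G : SimpleGraph n) {x y} → Adj G x y → Adj G y x
Adj-sym G {x} {y} = subst T (symm G x y)

Adj-irrefl : ∀ {n} (G : SimpleGraph n) {x y} → Adj G x y → x ≢ y
Adj-irrefl G {x} a refl = subst T (irrefl G x) a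

module _ {n} {G : SimpleGraph n} where

  edgeCount-≤ : ∀ {L} → (∀ {i j} → toℕ i < toℕ j → Adj G i j → (i , j) ∈ L) → edgeCount G ≤ length L
  edgeCount-≤ h = countTrue-≤ {xs = cartesianProduct (allFin n) (allFin n)}
    (Uniq.cartesianProduct⁺ (Uniq.allFin⁺ n) (Uniq.allFin⁺ n))
    λ {(i , j)} _ p → let l , a = to (T-∧ {toℕ i <ᵇ toℕ j}) p in h (<ᵇ⇒< (toℕ i) (toℕ j) l) a

  edgeCount-≥ : ∀ {L} → Unique L → (∀ {i j} → (i , j) ∈ L → toℕ i < toℕ j × Adj G i j) → length L ≤ edgeCount G
  edgeCount-≥ u h = countTrue-≥ {xs = cartesianProduct (allFin n) (allFin n)} u λ {(i , j)} p →
    let l , a = h p in ∈-cartesianProduct⁺ (∈-allFin i) (∈-allFin j) , from T-∧ (<⇒<ᵇ l , a)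

-- In `extend` the end `v` may lie inside or outside `X`, so one constructor covers both attaching a
-- new vertex and joining two old ones.
data Grown {n} (G : SimpleGraph n) : Sub n → Set where
  start  : ∀ v → Grown G (vertex v)
  extend : ∀ {X u v} → Grown G X → u ∈ᵥ X → Adj G u v → Grown G (X ⊕ (u , v))

module _ {n} {G : SimpleGraph n} where

  Grown-nonempty : ∀ {X} → Grown G X → ∃ λ r → r ∈ᵥ X × (∀ {x} → x ∈ᵥ X → Star (λ y z → z ∈ᵥ X × (y , z) ∈ₑ X) r x)
  Grown-nonempty (start v) = v , ∈ᵥ-vertex⁺ , λ p → subst (Star _ v) (sym (∈ᵥ-vertex⁻ p)) ε
  Grown-nonempty (extend {X} {u} {v} g u∈ a) with Grown-nonempty g
  ... | r , r∈ , conn = r , ⊑ᵥ ⊑-⊕ r∈ , conn′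
    where
    lift : ∀ {x} → Star (λ y z → z ∈ᵥ X × (y , z) ∈ₑ X) r x → Star (λ y z → z ∈ᵥ X ⊕ (u , v) × (y , z) ∈ₑ X ⊕ (u , v)) r x
    lift = Star.map (λ (p , q) → ⊑ᵥ ⊑-⊕ p , ⊑ₑ ⊑-⊕ q)
    conn′ : ∀ {x} → x ∈ᵥ X ⊕ (u , v) → Star (λ y z → z ∈ᵥ X ⊕ (u , v) × (y , z) ∈ₑ X ⊕ (u , v)) r x
    conn′ p with ∈ᵥ-⊕⁻ p
    ... | inj₁ q           = lift (conn q)
    ... | inj₂ (inj₁ refl) = lift (conn u∈)
    ... | inj₂ (inj₂ refl) = lift (conn u∈) ◅◅ ((⊕ᵥʳ , ⊕ₑ) ◅ ε)

  Grown-edge : ∀ {X x y} → Grown G X → (x , y) ∈ₑ X → Adj G x y × HasEdge (x , y) X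
  Grown-edge (start v) p = ⊥-elim (∉ₑ-vertex p)
  Grown-edge (extend {X} g u∈ a) p with ∈ₑ-⊕⁻ p
  ... | inj₁ q           = let b , h = Grown-edge g q in b , HasEdge-mono ⊑-⊕ h
  ... | inj₂ (inj₁ refl) = a , HasEdge-⊕
  ... | inj₂ (inj₂ refl) = Adj-sym G a , HasEdge-swap HasEdge-⊕

  IsConnectedSub : Sub n → Set
  IsConnectedSub X = T (isConnectedSubgraph G (proj₁ X) (proj₂ X))

  Grown⇒connected : ∀ {X} → Grown G X → IsConnectedSub X
  Grown⇒connected {X} g with Grown-nonempty g
  ... | r , r∈ , conn = from T-∧
    ( anyV⁺ r (bitᵥ r∈)
    , from T-∧ (allV⁺ (λ x → allV⁺ (λ y → from T-∧ (⇒⁺ (inside x y) , symmetric x y)))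
               , connectedB⁺ joined))
    where
    inside : ∀ x y → T (hasE X x y) → T (adj G x y ∧ hasV X x ∧ hasV X y)
    inside x y p = let a , hasEdge s t _ _ = Grown-edge g (mkₑ {e = x , y} p)
                   in from T-∧ (a , from T-∧ (bitᵥ s , bitᵥ t))
    ¬∧¬ : ∀ {a b} → (T a → T b) → T (not (a ∧ not b))
    ¬∧¬ {true}  {true}  f = _
    ¬∧¬ {true}  {false} f = f _
    ¬∧¬ {false} {_}     f = _
    symmetric : ∀ x y → T (not (hasE X x y ∧ not (hasE X y x)))
    symmetric x y = ¬∧¬ λ p → bitₑ (HasEdge.bwd∈ (proj₂ (Grown-edge g (mkₑ {e = x , y} p))))
    R : Fin n → Fin n → Set
    R y z = z ∈ᵥ X × (y , z) ∈ₑ X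
    flipR : ∀ {y z} → R y z → R z y
    flipR (_ , q) = let hasEdge s _ _ b = proj₂ (Grown-edge g q) in s , b
    joined : ∀ x y → T (hasV X x) → T (hasV X y) → Star (Reach (hasV X) (hasE X)) x y
    joined x y p q = Star.map (λ (a , b) → bitᵥ a , bitₑ b)
      (Star.reverse flipR (conn (mkᵥ p)) ◅◅ conn (mkᵥ q))

  -- Grow inside X: first along walks from r until all vertices are reached, then by the remaining edges.
  connected⇒Grown : ∀ {X} → IsConnectedSub X → Grown G X
  connected⇒Grown {X} h = subst (Grown G) (⊑-antisym Z⊑X X⊑Z) gZ
    where
    parts = to (T-∧ {anyV (hasV X)}) h
    localB : Fin n → Fin n → Bool
    localB x y = (not (hasE X x y) ∨ (adj G x y ∧ hasV X x ∧ hasV X y)) ∧ not (hasE X x y ∧ not (hasE X y x))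
    parts₂ = to (T-∧ {allV (λ x → allV (localB x))}) (proj₂ parts)
    r∃ = anyV⁻ {p = hasV X} (proj₁ parts)
    r : Fin n
    r = proj₁ r∃
    r∈ : r ∈ᵥ X
    r∈ = mkᵥ (proj₂ r∃)
    local = λ x y → to (T-∧ {not (hasE X x y) ∨ (adj G x y ∧ hasV X x ∧ hasV X y)}) (allV⁻ {p = localB x} (allV⁻ {p = λ x → allV (localB x)} (proj₁ parts₂) x) y)
    ⇒¬¬ : ∀ {a b} → T (not (a ∧ not b)) → T a → T b
    ⇒¬¬ {true} {true} _ _ = _
    edge : ∀ {x y} → (x , y) ∈ₑ X → Adj G x y × HasEdge (x , y) X
    edge {x} {y} (mkₑ p) =
      let a , b = to (T-∧ {adj G x y}) (⇒⁻ (proj₁ (local x y)) p)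
          c , d = to (T-∧ {hasV X x}) b
      in a , hasEdge (mkᵥ c) (mkᵥ d) (mkₑ p) (mkₑ (⇒¬¬ (proj₂ (local x y)) p))
    Stage : Sub n → Set
    Stage Y = Grown G Y × Y ⊑ X
    grow : ∀ {Y x y} → Stage Y → x ∈ᵥ Y → (x , y) ∈ₑ X → Stage (Y ⊕ (x , y))
    grow (g , l) x∈ e = let a , b = edge e in extend g x∈ a , ⊕-least l b
    along : ∀ {Y x z} → Stage Y → x ∈ᵥ Y → Star (Reach (hasV X) (hasE X)) x z →
            ∃ λ Z → Stage Z × Y ⊑ Z × z ∈ᵥ Z
    along s x∈ ε = _ , s , ⊑-refl , x∈
    along s x∈ ((_ , e) ◅ w) with along (grow s x∈ (mkₑ e)) ⊕ᵥʳ w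
    ... | Z , sZ , l , z∈ = Z , sZ , ⊑-trans ⊑-⊕ l , z∈
    vertices : ∀ xs → ∃ λ Z → Stage Z × r ∈ᵥ Z × (∀ {x} → x ∈ xs → x ∈ᵥ X → x ∈ᵥ Z)
    vertices [] = vertex r , (start r , vertex-⊑ r∈) , ∈ᵥ-vertex⁺ , λ ()
    vertices (x ∷ xs) with vertices xs
    ... | Y , sY , rY , f with x ∈ᵥ? X
    ...   | no x∉ = Y , sY , rY , λ { (here refl) q → contradiction q x∉ ; (there p) → f p }
    ...   | yes x∈ with along sY rY (connectedB⁻ (proj₂ parts₂) r x (bitᵥ r∈) (bitᵥ x∈))
    ...     | Z , sZ , l , xZ = Z , sZ , ⊑ᵥ l rY , λ { (here refl) _ → xZ ; (there p) q → ⊑ᵥ l (f p q) }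
    Y₀ = vertices (allFin n)
    edges : ∀ es → ∃ λ Z → Stage Z × proj₁ Y₀ ⊑ Z × (∀ {e} → e ∈ es → e ∈ₑ X → e ∈ₑ Z)
    edges [] = proj₁ Y₀ , proj₁ (proj₂ Y₀) , ⊑-refl , λ ()
    edges ((x , y) ∷ es) with edges es
    ... | Y , sY , l , f with T? (hasE X x y)
    ...   | no e∉ = Y , sY , l , λ { (here refl) q → contradiction (bitₑ q) e∉ ; (there p) → f p }
    ...   | yes e∈ = Y ⊕ (x , y) , grow sY x∈ (mkₑ e∈) , ⊑-trans l ⊑-⊕
                   , λ { (here refl) _ → ⊕ₑ ; (there p) q → ⊑ₑ ⊑-⊕ (f p q) }
      where
      x∈ : x ∈ᵥ Y
      x∈ = ⊑ᵥ l (proj₂ (proj₂ (proj₂ Y₀)) (∈-allFin x) (HasEdge.src∈ (proj₂ (edge (mkₑ {e = x , y} e∈)))))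
    final = edges (cartesianProduct (allFin n) (allFin n))
    gZ = proj₁ (proj₁ (proj₂ final))
    Z⊑X = proj₂ (proj₁ (proj₂ final))
    X⊑Z : X ⊑ proj₁ final
    X⊑Z = (λ {x} p → ⊑ᵥ (proj₁ (proj₂ (proj₂ final))) (proj₂ (proj₂ (proj₂ Y₀)) (∈-allFin x) p))
        , (λ {(x , y)} p → proj₂ (proj₂ (proj₂ final)) (∈-cartesianProduct⁺ (∈-allFin x) (∈-allFin y)) p)

  ∈-allSubs : (X : Sub n) → X ∈ cartesianProduct (allSubsets n) (allMatrices n)
  ∈-allSubs (V , E) = ∈-cartesianProduct⁺ (∈-vecsOver bits V) (∈-vecsOver (∈-vecsOver bits) E)
    where
    bits : ∀ b → b ∈ true ∷ false ∷ []
    bits true  = here refl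
    bits false = there (here refl)

  -- From here on the core index is accessed only through this bound and the next one; the encodings
  -- of subgraphs are not enumerated again.
  coreIndex-≥ : ∀ {L} → Unique L → (∀ {X} → X ∈ L → Grown G X) → length L ≤ coreIndex G
  coreIndex-≥ u h = countTrue-≥ u (λ {X} X∈ → ∈-allSubs X , Grown⇒connected (h X∈))

  coreIndex-≤ : ∀ {L} → (∀ {X} → Grown G X → X ∈ L) → coreIndex G ≤ length L
  coreIndex-≤ h = countTrue-≤
    (Uniq.cartesianProduct⁺ (vecsOver-unique bits n) (vecsOver-unique (vecsOver-unique bits n) n))
    (λ {X} _ p → h (connected⇒Grown p))
    where
    bits : Unique (true ∷ false ∷ [])
    bits = ((λ ()) ∷ []) ∷ [] ∷ []

-- Collections of connected subgraphs, grown vertex by vertex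

-- The first entry of (a , b) after k steps of (a , b) ↦ (a + b + 1 , b + 1).
total : ℕ → ℕ → ℕ → ℕ
total a b zero    = a
total a b (suc k) = total a b k + suc (b + k)

Within : ∀ {n} → List (Fin n) → Sub n → Set
Within S X = ∀ x → x ∈ᵥ X → x ∈ S

module _ {n} (G : SimpleGraph n) where

  record Collection (P : Sub n → Set) (k : ℕ) : Set where
    field
      list   : List (Sub n)
      unique : Unique list
      grown  : ∀ {X} → X ∈ list → Grown G X
      good   : ∀ {X} → X ∈ list → P X
      size   : length list ≡ k

  open Collection

  weaken : ∀ {P Q k} → (∀ {X} → P X → Q X) → Collection P k → Collection Q k
  weaken f C = record { Collection C ; good = f ∘ good C }

  singleton : ∀ {X} → Grown G X → Collection (_≡ X) 1
  singleton {X} g = record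
    { list = X ∷ [] ; unique = [] ∷ [] ; grown = λ { (here refl) → g } ; good = λ { (here p) → p } ; size = refl }

  append : ∀ {P Q k l} → (∀ {X} → P X → Q X → ⊥) → Collection P k → Collection Q l →
           Collection (λ X → P X ⊎ Q X) (k + l)
  append {P} {Q} disj C D = record
    { list   = list C ++ list D
    ; unique = Uniq.++⁺ (unique C) (unique D) (λ (p , q) → disj (good C p) (good D q))
    ; grown  = λ p → [ grown C , grown D ]′ (∈-++⁻ (list C) p)
    ; good   = λ p → [ inj₁ ∘ good C , inj₂ ∘ good D ]′ (∈-++⁻ (list C) p)
    ; size   = trans (length-++ (list C)) (cong₂ _+_ (size C) (size D))
    }

  -- The sizes agree because adding `wv` can be undone: no member of the old collection contains
  -- `v`, and all of them contain `w`, so the only new pieces are `v` and the edge itself.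
  attach : ∀ {S w v k} → v ∉ S → Adj G w v → Collection (λ X → Within S X × w ∈ᵥ X) k →
           Collection (λ X → Within (v ∷ S) X × v ∈ᵥ X × w ∈ᵥ X) k
  attach {S} {w} {v} v∉ a C = record
    { list   = map (_⊕ (w , v)) (list C)
    ; unique = Unique-map (λ p q eq → ⊑-antisym (cancel p q eq) (cancel q p (sym eq))) (unique C)
    ; grown  = grown′
    ; good   = good′
    ; size   = trans (length-map _ (list C)) (size C)
    }
    where
    cancel : ∀ {X Y} → X ∈ list C → Y ∈ list C → X ⊕ (w , v) ≡ Y ⊕ (w , v) → X ⊑ Y
    cancel {X} {Y} p q eq = cV , cE
      where
      v∉X : ¬ v ∈ᵥ X
      v∉X = v∉ ∘ proj₁ (good C p) v
      cV : ∀ {x} → x ∈ᵥ X → x ∈ᵥ Y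
      cV x∈ with ∈ᵥ-⊕⁻ (subst (_ ∈ᵥ_) eq (⊑ᵥ ⊑-⊕ x∈))
      ... | inj₁ h           = h
      ... | inj₂ (inj₁ refl) = proj₂ (good C q)
      ... | inj₂ (inj₂ refl) = contradiction x∈ v∉X
      cE : ∀ {e} → e ∈ₑ X → e ∈ₑ Y
      cE e∈ with ∈ₑ-⊕⁻ (subst (_ ∈ₑ_) eq (⊑ₑ ⊑-⊕ e∈))
      ... | inj₁ h           = h
      ... | inj₂ (inj₁ refl) = contradiction (HasEdge.tgt∈ (proj₂ (Grown-edge (grown C p) e∈))) v∉X
      ... | inj₂ (inj₂ refl) = contradiction (HasEdge.src∈ (proj₂ (Grown-edge (grown C p) e∈))) v∉X
    grown′ : ∀ {X} → X ∈ map (_⊕ (w , v)) (list C) → Grown G X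
    grown′ p with ∈-map⁻ (_⊕ (w , v)) p
    ... | Y , Y∈ , refl = extend (grown C Y∈) (proj₂ (good C Y∈)) a
    good′ : ∀ {X} → X ∈ map (_⊕ (w , v)) (list C) → Within (v ∷ S) X × v ∈ᵥ X × w ∈ᵥ X
    good′ p with ∈-map⁻ (_⊕ (w , v)) p
    ... | Y , Y∈ , refl = inside , ⊕ᵥʳ , ⊕ᵥˡ
      where
      inside : Within (v ∷ S) (Y ⊕ (w , v))
      inside _ x∈ with ∈ᵥ-⊕⁻ x∈
      ... | inj₁ h           = there (proj₁ (good C Y∈) _ h)
      ... | inj₂ (inj₁ refl) = there (proj₁ (good C Y∈) _ (proj₂ (good C Y∈)))
      ... | inj₂ (inj₂ refl) = here refl

  -- The number `b` must serve every vertex of `S` at once, because nothing is known about where the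
  -- next leaf is attached. The subgraph `whole` is carried along since, after a leaf has been added
  -- to it, it is the one new subgraph that every old vertex is sure to gain.
  record Rich (S : List (Fin n)) (a b : ℕ) : Set where
    field
      whole    : Sub n
      whole-g  : Grown G whole
      whole-in : Within S whole
      whole-∋  : ∀ {x} → x ∈ S → x ∈ᵥ whole
      inside   : Collection (Within S) a
      through  : ∀ {w} → w ∈ S → Collection (λ X → Within S X × w ∈ᵥ X) b

  open Rich

  Rich-leaf : ∀ {S a b w v} → w ∈ S → v ∉ S → Adj G w v → Rich S a b → Rich (v ∷ S) (a + suc b) (suc b)
  Rich-leaf {S} {a} {b} {w} {v} w∈ v∉ adj-wv R = record
    { whole    = whole R ⊕ (w , v)
    ; whole-g  = grown-W
    ; whole-in = in-W
    ; whole-∋  = λ { (here refl) → ⊕ᵥʳ ; (there x∈) → ⊑ᵥ ⊑-⊕ (whole-∋ R x∈) }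
    ; inside   = weaken [ (λ h x → there ∘ h x) , proj₁ ]′ (append (λ h (_ , v∈) → v∉ (h v v∈)) (inside R) through-v)
    ; through  = λ { (here refl) → through-v ; (there x∈) → through-old x∈ }
    }
    where
    grown-W : Grown G (whole R ⊕ (w , v))
    grown-W = extend (whole-g R) (whole-∋ R w∈) adj-wv
    in-W : Within (v ∷ S) (whole R ⊕ (w , v))
    in-W _ x∈ with ∈ᵥ-⊕⁻ x∈
    ... | inj₁ h           = there (whole-in R _ h)
    ... | inj₂ (inj₁ refl) = there w∈
    ... | inj₂ (inj₂ refl) = here refl
    through-v : Collection (λ X → Within (v ∷ S) X × v ∈ᵥ X) (suc b)
    through-v = weaken
      [ (λ { refl → (λ _ x∈ → here (∈ᵥ-vertex⁻ x∈)) , ∈ᵥ-vertex⁺ }) , (λ (p , q , _) → p , q) ]′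
      (append (λ { refl (_ , _ , w∈X) → v∉ (subst (_∈ S) (∈ᵥ-vertex⁻ w∈X) w∈) })
        (singleton (start v)) (attach v∉ adj-wv (through R w∈)))
    through-old : ∀ {x} → x ∈ S → Collection (λ X → Within (v ∷ S) X × x ∈ᵥ X) (suc b)
    through-old x∈ = weaken
      [ (λ { refl → in-W , ⊑ᵥ ⊑-⊕ (whole-∋ R x∈) }) , (λ (p , q) → (λ x → there ∘ p x) , q) ]′
      (append (λ { refl (p , _) → v∉ (p v ⊕ᵥʳ) }) (singleton grown-W) (through R x∈))

  Rich-vertex : ∀ x → Rich (x ∷ []) 1 1
  Rich-vertex x = record
    { whole    = vertex x
    ; whole-g  = start x
    ; whole-in = λ _ → here ∘ ∈ᵥ-vertex⁻
    ; whole-∋  = λ { (here refl) → ∈ᵥ-vertex⁺ }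
    ; inside   = weaken (λ { refl → λ _ → here ∘ ∈ᵥ-vertex⁻ }) (singleton (start x))
    ; through  = λ { (here refl) → weaken (λ { refl → (λ _ → here ∘ ∈ᵥ-vertex⁻) , ∈ᵥ-vertex⁺ }) (singleton (start x)) }
    }

  -- A path is built by adding leaves at its front. The total obtained is the exact number of
  -- subpaths; the bound through a vertex is what an end vertex attains.
  Rich-path : ∀ {x ys z} → Walk (Adj G) x ys z → Unique (x ∷ ys) →
              Rich (x ∷ ys) (total 1 1 (length ys)) (suc (length ys))
  Rich-path {x} []      _       = Rich-vertex x
  Rich-path     (a ∷ w) (x∉ ∷ u) = Rich-leaf (here refl) (All¬⇒¬Any x∉) (Adj-sym G a) (Rich-path w u)

  -- Absorbing all vertices of a connected graph one at a time

  module _ (conn : ∀ x y → Star (Adj G) x y) where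

    exit-edge : ∀ {S x z} → Star (Adj G) x z → x ∈ S → z ∉ S → ∃₂ λ w v → w ∈ S × v ∉ S × Adj G w v
    exit-edge ε x∈ z∉ = contradiction x∈ z∉
    exit-edge {S} (_◅_ {j = y} a s) x∈ z∉ with Any.any? (y ≟_) S
    ... | yes y∈ = exit-edge s y∈ z∉
    ... | no  y∉ = _ , _ , x∈ , y∉ , a

    -- The invariant `P` is left open because the same exploration is run twice: with counts of
    -- subgraphs when leaves are added to a cycle, and with partial spanning trees when a cycle has
    -- to be found.
    grow-spanning : (P : List (Fin n) → Set) → (∀ {S w v} → w ∈ S → v ∉ S → Adj G w v → P S → P (v ∷ S)) →
                    ∀ {S r} → Unique S → r ∈ S → P S → ∃ λ S′ → P S′ × Unique S′ × (∀ v → v ∈ S′)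
    grow-spanning P step {S} u r∈ p = go n (m≤n+m n (length S)) u r∈ p
      where
      go : ∀ k {S r} → n ≤ length S + k → Unique S → r ∈ S → P S → ∃ λ S′ → P S′ × Unique S′ × (∀ v → v ∈ S′)
      go k {S} {r} le u r∈ p with all? (λ v → Any.any? (v ≟_) S)
      ... | yes all = S , p , u , all
      ... | no ¬all with ¬∀⟶∃¬ n (_∈ S) (λ v → Any.any? (v ≟_) S) ¬all
      ...   | z , z∉ with exit-edge (conn r z) r∈ z∉
      ...     | w , v , w∈ , v∉ , a with k
      ...       | suc k = go k (≤-trans le (≤-reflexive (+-suc (length S) k))) (¬Any⇒All¬ _ v∉ ∷ u) (there r∈) (step w∈ v∉ a p)
      -- The fuel `k` bounds the number of vertices still outside `S`. If it is used up, `v ∷ S`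
      -- would be a repetition-free list of more than n vertices.
      ...       | zero = contradiction (Unique⇒length≤ {xs = v ∷ S} (¬Any⇒All¬ _ v∉ ∷ u))
                           (<⇒≱ (s≤s (≤-trans le (≤-reflexive (+-identityʳ _)))))

    Rich⇒coreIndex : ∀ {S a b} → Rich S a b → Unique S → ∀ {r} → r ∈ S →
                     ∃ λ k → length S + k ≡ n × total a b k ≤ coreIndex G
    Rich⇒coreIndex {S₀} {a} {b} R u r∈ = conclude (grow-spanning P leaf u r∈ (0 , +-identityʳ _ , R₀))
      where
      P : List (Fin n) → Set
      P S = ∃ λ k → length S₀ + k ≡ length S × Rich S (total a b k) (b + k)
      R₀ : Rich S₀ a (b + 0)
      R₀ = subst (Rich S₀ a) (sym (+-identityʳ b)) R
      leaf : ∀ {S w v} → w ∈ S → v ∉ S → Adj G w v → P S → P (v ∷ S)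
      leaf {S} {v = v} w∈ v∉ a′ (k , len , R′) =
        suc k , trans (+-suc _ k) (cong suc len)
        , subst (Rich (v ∷ S) _) (sym (+-suc b k)) (Rich-leaf w∈ v∉ a′ R′)
      conclude : (∃ λ S → P S × Unique S × (∀ v → v ∈ S)) → ∃ λ k → length S₀ + k ≡ n × total a b k ≤ coreIndex G
      conclude (S , (k , len , R′) , u′ , all) =
        k , trans len (≤-antisym (Unique⇒length≤ u′) full)
        , subst (_≤ coreIndex G) (size (inside R′)) (coreIndex-≥ (unique (inside R′)) (grown (inside R′)))
        where
        full : n ≤ length S
        full = ≤-trans (≤-reflexive (sym (length-tabulate {n = n} id)))
                 (Unique⇒length-mono (Uniq.allFin⁺ n) (λ {v} _ → all v))

-- Arcs of a cycle, encoded by boolean words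

-- There is one letter for each edge of the walk from `u` along `ys`, and it decides whether that
-- edge is added. The seed `X` holds what the word does not describe: the root, and possibly the
-- closing edge of the cycle. Distinctness and number of arcs thus reduce to distinctness and number
-- of words.
run : ∀ {n} → Sub n → Fin n → (ys : List (Fin n)) → Vec Bool (length ys) → Sub n
run X u []       []           = X
run X u (y ∷ ys) (true  ∷ bs) = run (X ⊕ (u , y)) y ys bs
run X u (y ∷ ys) (false ∷ bs) = run X y ys bs

-- Words of the forms 1ⁱ0ʲ, 0ʲ1ᵏ and 1ⁱ0ʲ1ᵏ, respectively.
prefixWords suffixWords outerWords : (m : ℕ) → List (Vec Bool m)
prefixWords zero    = [] ∷ []
prefixWords (suc m) = replicate _ false ∷ map (true ∷_) (prefixWords m)
suffixWords zero    = [] ∷ []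
suffixWords (suc m) = replicate _ true ∷ map (false ∷_) (suffixWords m)
outerWords zero    = [] ∷ []
outerWords (suc m) = map (false ∷_) (suffixWords m) ++ map (true ∷_) (outerWords m)

triangular : ℕ → ℕ
triangular zero    = 0
triangular (suc m) = suc m + triangular m

total-1-1 : ∀ k → total 1 1 k ≡ triangular (suc k)
total-1-1 zero    = refl
total-1-1 (suc k) = trans (cong (_+ suc (suc k)) (total-1-1 k)) (+-comm (triangular (suc k)) _)

module _ {m : ℕ} where

  ∷-map-unique : ∀ {b} {bss : List (Vec Bool m)} → Unique bss → Unique (map (b ∷_) bss)
  ∷-map-unique = Uniq.map⁺ (proj₂ ∘ ∷-injective)

  ∷-map-∌ : ∀ {b c} {bs : Vec Bool m} {bss} → b ≢ c → b ∷ bs ∉ map (c ∷_) bss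
  ∷-map-∌ ne p with ∈-map⁻ (_ ∷_) p
  ... | _ , _ , refl = ne refl

prefixWords-unique : ∀ m → Unique (prefixWords m)
prefixWords-unique zero    = [] ∷ []
prefixWords-unique (suc m) = ¬Any⇒All¬ _ (∷-map-∌ λ ()) ∷ ∷-map-unique (prefixWords-unique m)

suffixWords-unique : ∀ m → Unique (suffixWords m)
suffixWords-unique zero    = [] ∷ []
suffixWords-unique (suc m) = ¬Any⇒All¬ _ (∷-map-∌ λ ()) ∷ ∷-map-unique (suffixWords-unique m)

outerWords-unique : ∀ m → Unique (outerWords m)
outerWords-unique zero    = [] ∷ []
outerWords-unique (suc m) = Uniq.++⁺ (∷-map-unique (suffixWords-unique m)) (∷-map-unique (outerWords-unique m)) disjoint
  where
  disjoint : ∀ {bs : Vec Bool (suc m)} → bs ∈ map (false ∷_) (suffixWords m) × bs ∈ map (true ∷_) (outerWords m) → ⊥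
  disjoint (p , q) with ∈-map⁻ (false ∷_) p
  ... | _ , _ , refl = ∷-map-∌ (λ ()) q

length-prefixWords : ∀ m → length (prefixWords m) ≡ suc m
length-prefixWords zero    = refl
length-prefixWords (suc m) = cong suc (trans (length-map _ (prefixWords m)) (length-prefixWords m))

length-suffixWords : ∀ m → length (suffixWords m) ≡ suc m
length-suffixWords zero    = refl
length-suffixWords (suc m) = cong suc (trans (length-map _ (suffixWords m)) (length-suffixWords m))

length-outerWords : ∀ m → length (outerWords m) ≡ suc (triangular m)
length-outerWords zero    = refl
length-outerWords (suc m) = trans (length-++ (map (false ∷_) (suffixWords m)))
  (trans (cong₂ _+_ (trans (length-map _ (suffixWords m)) (length-suffixWords m))
                    (trans (length-map _ (outerWords m)) (length-outerWords m)))
         (+-suc (suc m) (triangular m)))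

module _ {n : ℕ} where

  run-⊒ : ∀ {X : Sub n} {u} ys bs → X ⊑ run X u ys bs
  run-⊒ []       []           = ⊑-refl
  run-⊒ (y ∷ ys) (true  ∷ bs) = ⊑-trans ⊑-⊕ (run-⊒ ys bs)
  run-⊒ (y ∷ ys) (false ∷ bs) = run-⊒ ys bs

  run-∈ᵥ : ∀ {X : Sub n} {u x} ys bs → x ∈ᵥ run X u ys bs → x ∈ᵥ X ⊎ x ∈ u ∷ ys
  run-∈ᵥ []       []           p = inj₁ p
  run-∈ᵥ (y ∷ ys) (true  ∷ bs) p with run-∈ᵥ ys bs p
  ... | inj₂ q = inj₂ (there q)
  ... | inj₁ q with ∈ᵥ-⊕⁻ q
  ...   | inj₁ r           = inj₁ r
  ...   | inj₂ (inj₁ refl) = inj₂ (here refl)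
  ...   | inj₂ (inj₂ refl) = inj₂ (there (here refl))
  run-∈ᵥ (y ∷ ys) (false ∷ bs) p with run-∈ᵥ ys bs p
  ... | inj₁ q = inj₁ q
  ... | inj₂ q = inj₂ (there q)

  run-∈ₑ : ∀ {X : Sub n} {u s t} ys bs → s ∉ u ∷ ys → (s , t) ∈ₑ run X u ys bs → (s , t) ∈ₑ X
  run-∈ₑ []       []           s∉ p = p
  run-∈ₑ (y ∷ ys) (true  ∷ bs) s∉ p with ∈ₑ-⊕⁻ (run-∈ₑ ys bs (s∉ ∘ there) p)
  ... | inj₁ q           = q
  ... | inj₂ (inj₁ refl) = contradiction (here refl) s∉
  ... | inj₂ (inj₂ refl) = contradiction (there (here refl)) s∉
  run-∈ₑ (y ∷ ys) (false ∷ bs) s∉ p = run-∈ₑ ys bs (s∉ ∘ there) p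

  Lacks : Sub n → Fin n → List (Fin n) → Set
  Lacks X u []       = ⊤
  Lacks X u (y ∷ ys) = ¬ (u , y) ∈ₑ X × Lacks X y ys

  Lacks-vertex : ∀ {v u} ys → Lacks (vertex v) u ys
  Lacks-vertex []       = tt
  Lacks-vertex (y ∷ ys) = ∉ₑ-vertex , Lacks-vertex ys

  Lacks-⊕ : ∀ {X u t y} ys → u ∉ y ∷ ys → Lacks X y ys → Lacks (X ⊕ (u , t)) y ys
  Lacks-⊕ []       u∉ _       = tt
  Lacks-⊕ {X} {u} {t} {y} (z ∷ ys) u∉ (h , l) = fresh , Lacks-⊕ ys (u∉ ∘ there) l
    where
    fresh : ¬ (y , z) ∈ₑ X ⊕ (u , t)
    fresh p with ∈ₑ-⊕⁻ p
    ... | inj₁ q           = h q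
    ... | inj₂ (inj₁ refl) = u∉ (here refl)
    ... | inj₂ (inj₂ refl) = u∉ (there (here refl))

  -- The first letter can be read off from the result: the edge from `u` to `y` is not in the seed,
  -- and since the walk never returns to `u`, no later letter can add it.
  run-injective : ∀ {X u} ys {bs cs} → Unique (u ∷ ys) → Lacks X u ys → run X u ys bs ≡ run X u ys cs → bs ≡ cs
  run-injective [] {[]} {[]} _ _ _ = refl
  run-injective (y ∷ ys) {true ∷ bs} {true ∷ cs} (u∉ ∷ uq) (_ , l) eq =
    cong (true ∷_) (run-injective ys uq (Lacks-⊕ ys (All¬⇒¬Any u∉) l) eq)
  run-injective (y ∷ ys) {false ∷ bs} {false ∷ cs} (_ ∷ uq) (_ , l) eq = cong (false ∷_) (run-injective ys uq l eq)
  run-injective (y ∷ ys) {true ∷ bs} {false ∷ cs} (u∉ ∷ uq) (h , _) eq =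
    contradiction (run-∈ₑ ys cs (All¬⇒¬Any u∉) (subst (_ ∈ₑ_) eq (⊑ₑ (run-⊒ ys bs) ⊕ₑ))) h
  run-injective (y ∷ ys) {false ∷ bs} {true ∷ cs} (u∉ ∷ uq) (h , _) eq =
    contradiction (run-∈ₑ ys bs (All¬⇒¬Any u∉) (subst (_ ∈ₑ_) (sym eq) (⊑ₑ (run-⊒ ys cs) ⊕ₑ))) h

  run-⊕ : ∀ {X : Sub n} {u e} ys bs → run (X ⊕ e) u ys bs ≡ run X u ys bs ⊕ e
  run-⊕ []       []           = refl
  run-⊕ {X} (y ∷ ys) (true  ∷ bs) = trans (cong (λ Z → run Z y ys bs) ⊕-comm) (run-⊕ ys bs)
  run-⊕ (y ∷ ys) (false ∷ bs) = run-⊕ ys bs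

  run-zeros : ∀ {X : Sub n} {u} ys → run X u ys (replicate _ false) ≡ X
  run-zeros []       = refl
  run-zeros (y ∷ ys) = run-zeros ys

module _ {n} {G : SimpleGraph n} where

  Grown-prefix : ∀ {X u ys z bs} → Walk (Adj G) u ys z → Grown G X → u ∈ᵥ X →
                 bs ∈ prefixWords (length ys) → Grown G (run X u ys bs)
  Grown-prefix []      g u∈ (here refl) = g
  Grown-prefix {ys = y ∷ ys} (a ∷ w) g u∈ (here refl) = subst (Grown G) (sym (run-zeros ys)) g
  Grown-prefix (a ∷ w) g u∈ (there p) with ∈-map⁻ (true ∷_) p
  ... | _ , q , refl = Grown-prefix w (extend g u∈ a) ⊕ᵥʳ q

  -- Here the seed meets the walk at its far end `z`, whereas `run` adds edges from `u` onwards. The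
  -- recursion therefore treats the later edges first, and `run-⊕` and `⊕-swap` move the first edge
  -- to the end and reverse it.
  Grown-ones : ∀ {X u ys z} → Walk (Adj G) u ys z → Grown G X → z ∈ᵥ X →
               Grown G (run X u ys (replicate _ true)) × u ∈ᵥ run X u ys (replicate _ true)
  Grown-ones [] g z∈ = g , z∈
  Grown-ones {X} {u} {y ∷ ys} (a ∷ w) g z∈ with Grown-ones w g z∈
  ... | h , y∈ = subst (λ Z → Grown G Z × u ∈ᵥ Z) (sym (trans (run-⊕ ys _) ⊕-swap))
                   (extend h y∈ (Adj-sym G a) , ⊕ᵥʳ)

  Grown-suffix : ∀ {X u ys z bs} → Walk (Adj G) u ys z → Grown G X → z ∈ᵥ X →
                 bs ∈ suffixWords (length ys) → Grown G (run X u ys bs)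
  Grown-suffix []      g z∈ (here refl) = g
  Grown-suffix (a ∷ w) g z∈ (here refl) = proj₁ (Grown-ones (a ∷ w) g z∈)
  Grown-suffix (a ∷ w) g z∈ (there p) with ∈-map⁻ (false ∷_) p
  ... | _ , q , refl = Grown-suffix w g z∈ q

  -- Leading ones grow the subgraph forwards from `u`. The first zero breaks this growth, and from
  -- there on the ones can only form a suffix that hangs on `z`.
  Grown-outer : ∀ {X u ys z bs} → Walk (Adj G) u ys z → Grown G X → u ∈ᵥ X → z ∈ᵥ X →
                bs ∈ outerWords (length ys) → Grown G (run X u ys bs)
  Grown-outer [] g u∈ z∈ (here refl) = g
  Grown-outer {ys = y ∷ ys} (a ∷ w) g u∈ z∈ p with ∈-++⁻ (map (false ∷_) (suffixWords (length ys))) p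
  ... | inj₁ q with ∈-map⁻ (false ∷_) q
  ...   | _ , r , refl = Grown-suffix w g z∈ r
  Grown-outer {ys = y ∷ ys} (a ∷ w) g u∈ z∈ p | inj₂ q with ∈-map⁻ (true ∷_) q
  ...   | _ , r , refl = Grown-outer w (extend g u∈ a) ⊕ᵥʳ (⊑ᵥ ⊑-⊕ z∈) r

  words : ∀ {P : Sub n → Set} {X u} ys {bss} → Unique (u ∷ ys) → Lacks X u ys → Unique bss →
          (∀ {bs} → bs ∈ bss → Grown G (run X u ys bs)) → (∀ bs → P (run X u ys bs)) →
          Collection G P (length bss)
  words {P} {X} {u} ys {bss} uq l uw g h = record
    { list   = map (run X u ys) bss
    ; unique = Unique-map (λ _ _ → run-injective ys uq l) uw
    ; grown  = grown′
    ; good   = good′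
    ; size   = length-map _ bss
    }
    where
    grown′ : ∀ {Z} → Z ∈ map (run X u ys) bss → Grown G Z
    grown′ p with ∈-map⁻ (run X u ys) p
    ... | _ , q , refl = g q
    good′ : ∀ {Z} → Z ∈ map (run X u ys) bss → P Z
    good′ p with ∈-map⁻ (run X u ys) p
    ... | bs , _ , refl = h bs

  record Cycle (w : Fin n) (rs : List (Fin n)) : Set where
    field
      {last}  : Fin n
      walk    : Walk (Adj G) w rs last
      simple  : Unique (w ∷ rs)
      closing : Adj G last w
      long    : 2 ≤ length rs

  -- On the edges other than the closing one, an arc through w is a word 1ⁱ0ʲ if it avoids the closing edge,
  -- and 1ⁱ0ʲ1ᵏ if it contains it.
  Cycle-through-root : ∀ {w rs} → Cycle w rs →
    Collection G (λ X → Within (w ∷ rs) X × w ∈ᵥ X) (suc (triangular (suc (length rs))))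
  Cycle-through-root {w} {[]} record { long = () }
  Cycle-through-root {w} {_ ∷ []} record { long = s≤s () }
  Cycle-through-root {w} {rs@(y ∷ ys@(_ ∷ _))}
    record { last = z ; walk = a ∷ (a₂ ∷ wk) ; simple = uq@(w∉ ∷ (y∉ ∷ _)) ; closing = c } =
    subst (Collection G _) sizes (weaken G [ proj₁ , proj₁ ]′ (append G (λ (_ , ¬p) (_ , p) → ¬p p) open-arcs closed-arcs))
    where
    -- The cycle has at least three vertices, so the closing edge `wz` differs from the first edge
    -- `wy`. This keeps the two families of arcs disjoint and lets the first letter still be read
    -- off when the seed contains `wz`.
    y≢z : y ≢ z
    y≢z = All.lookup y∉ (end∈ wk)
    w∉rs : w ∉ rs
    w∉rs = All¬⇒¬Any w∉
    P : Sub n → Set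
    P X = Within (w ∷ rs) X × w ∈ᵥ X
    -- The closing edge is put in before the word is read, so that growth is possible from both ends
    -- of the walk.
    start-z = vertex w ⊕ (w , z)
    not-closing : ∀ bs → ¬ (w , z) ∈ₑ run (vertex w) w rs bs
    not-closing (true ∷ bs) p with ∈ₑ-⊕⁻ (run-∈ₑ ys bs w∉rs p)
    ... | inj₁ q           = ∉ₑ-vertex q
    ... | inj₂ (inj₁ refl) = y≢z refl
    ... | inj₂ (inj₂ refl) = w∉rs (here refl)
    not-closing (false ∷ bs) p = ∉ₑ-vertex (run-∈ₑ ys bs w∉rs p)
    open-P : ∀ bs → P (run (vertex w) w rs bs)
    open-P bs = (λ x x∈ → [ here ∘ ∈ᵥ-vertex⁻ , id ]′ (run-∈ᵥ rs bs x∈)) , ⊑ᵥ (run-⊒ rs bs) ∈ᵥ-vertex⁺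
    open-arcs : Collection G (λ X → P X × ¬ (w , z) ∈ₑ X) (length (prefixWords (length rs)))
    open-arcs = words rs uq (Lacks-vertex rs) (prefixWords-unique _)
      (Grown-prefix (a ∷ (a₂ ∷ wk)) (start w) ∈ᵥ-vertex⁺) (λ bs → open-P bs , not-closing bs)
    lacks-z : Lacks start-z w rs
    lacks-z = fresh , Lacks-⊕ ys w∉rs (Lacks-vertex ys)
      where
      fresh : ¬ (w , y) ∈ₑ start-z
      fresh p with ∈ₑ-⊕⁻ p
      ... | inj₁ q           = ∉ₑ-vertex q
      ... | inj₂ (inj₁ refl) = y≢z refl
      ... | inj₂ (inj₂ refl) = w∉rs (here refl)
    start-z-in : Within (w ∷ rs) start-z
    start-z-in x x∈ with ∈ᵥ-⊕⁻ x∈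
    ... | inj₁ q           = here (∈ᵥ-vertex⁻ q)
    ... | inj₂ (inj₁ refl) = here refl
    ... | inj₂ (inj₂ refl) = there (there (end∈ wk))
    closed-P : ∀ bs → P (run start-z w rs bs)
    closed-P bs = (λ x x∈ → [ start-z-in x , id ]′ (run-∈ᵥ rs bs x∈)) , ⊑ᵥ (run-⊒ rs bs) ⊕ᵥˡ
    closed-arcs : Collection G (λ X → P X × (w , z) ∈ₑ X) (length (outerWords (length rs)))
    closed-arcs = words rs uq lacks-z (outerWords-unique _)
      (Grown-outer (a ∷ (a₂ ∷ wk)) (extend (start w) ∈ᵥ-vertex⁺ (Adj-sym G c)) ⊕ᵥˡ ⊕ᵥʳ)
      (λ bs → closed-P bs , ⊑ₑ (run-⊒ rs bs) ⊕ₑ)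
    sizes : length (prefixWords (length rs)) + length (outerWords (length rs)) ≡ suc (triangular (suc (length rs)))
    sizes = trans (cong₂ _+_ (length-prefixWords (length rs)) (length-outerWords (length rs)))
                  (+-suc (suc (length rs)) (triangular (length rs)))

  Walk-split : ∀ {w rs z x} → Walk (Adj G) w rs z → x ∈ rs →
    ∃ λ as → ∃₂ λ bs u → rs ≡ as ++ x ∷ bs × Walk (Adj G) w as u × Adj G u x × Walk (Adj G) x bs z
  Walk-split (a ∷ wk) (here refl) = [] , _ , _ , refl , [] , a , wk
  Walk-split (a ∷ wk) (there x∈) with Walk-split wk x∈
  ... | as , bs , u , refl , w₁ , b , w₂ = _ ∷ as , bs , u , refl , a ∷ w₁ , b , w₂

  -- Cutting the cycle open at `x` instead of `w` makes any vertex the root, which carries the count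
  -- through the root over to all vertices.
  Cycle-rotate : ∀ {w rs x} → Cycle w rs → x ∈ w ∷ rs →
    ∃ λ rs′ → Cycle x rs′ × length rs′ ≡ length rs × (∀ {y} → y ∈ x ∷ rs′ → y ∈ w ∷ rs)
  Cycle-rotate C (here refl) = _ , C , refl , id
  Cycle-rotate {w} {x = x} C (there x∈) with Walk-split (Cycle.walk C) x∈
  ... | as , bs , u , refl , w₁ , b , w₂ = bs ++ w ∷ as , record
      { walk    = Walk-++ w₂ (Cycle.closing C ∷ w₁)
      ; simple  = Perm.Unique-resp-↭ (setoid (Fin n)) (Perm.++-comm (setoid (Fin n)) (w ∷ as) (x ∷ bs)) (Cycle.simple C)
      ; closing = b
      ; long    = subst (2 ≤_) (sym same) (Cycle.long C)
      } , same , λ y∈ → [ ∈-++⁺ʳ (w ∷ as) , ∈-++⁺ˡ ]′ (∈-++⁻ (x ∷ bs) y∈)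
    where
    same : length (bs ++ w ∷ as) ≡ length (as ++ x ∷ bs)
    same = suc-injective (trans (cong suc (length-++ bs)) (trans (+-comm (suc (length bs)) (suc (length as)))
             (cong suc (sym (length-++ as)))))

  Rich-cycle : ∀ {w rs} → Cycle w rs →
    Rich G (w ∷ rs) (suc (triangular (suc (length rs))) + triangular (length rs)) (suc (triangular (suc (length rs))))
  Rich-cycle {w} {[]} record { long = () }
  Rich-cycle {w} {y ∷ ys} C@record { walk = a ∷ wk ; simple = w∉ ∷ uq } = record
    { whole    = Rich.whole P
    ; whole-g  = Rich.whole-g P
    ; whole-in = Rich.whole-in P
    ; whole-∋  = Rich.whole-∋ P
    -- The subgraphs are split by whether they contain the root; those that avoid it are the
    -- subpaths of the path `y ∷ ys` left after deleting it. For length c the sum is 1 + c(c + 1)/2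
    -- + (c - 1)c/2 = c² + 1.
    ; inside   = weaken G [ proj₁ , (λ h x → there ∘ h x) ]′
        (append G (λ (_ , w∈) h → All¬⇒¬Any w∉ (h w w∈)) (Cycle-through-root C)
          (subst (Collection G _) (total-1-1 (length ys)) (Rich.inside (Rich-path G wk uq))))
    ; through  = through
    }
    where
    -- Only a connected subgraph on all vertices of the cycle is wanted as `whole`; the cycle
    -- without its closing edge is one.
    P = Rich-path G (a ∷ wk) (w∉ ∷ uq)
    through : ∀ {x} → x ∈ w ∷ y ∷ ys →
              Collection G (λ X → Within (w ∷ y ∷ ys) X × x ∈ᵥ X) (suc (triangular (suc (suc (length ys)))))
    through {x} x∈ with Cycle-rotate C x∈
    ... | rs′ , C′ , len , sub = subst (λ k → Collection G (λ X → Within (w ∷ y ∷ ys) X × x ∈ᵥ X) (suc (triangular (suc k)))) len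
            (weaken G (λ (h , p) → (λ z → sub ∘ h z) , p) (Cycle-through-root C′))

-- Finding a cycle

module _ {n} {G : SimpleGraph n} where

  Connected⇒Star : Connected G → ∀ x y → Star (Adj G) x y
  Connected⇒Star c x y = Star.map proj₂ (connectedB⁻ {V = λ _ → true} (from T-≡ c) x y _ _)

  Covered : List (Fin n × Fin n) → Fin n → Fin n → Set
  Covered F x y = (x , y) ∈ F ⊎ (y , x) ∈ F

  Covered-there : ∀ {F e x y} → Covered F x y → Covered (e ∷ F) x y
  Covered-there = [ inj₁ ∘ there , inj₂ ∘ there ]′

  record SpanningTree : Set where
    field
      edges    : List (Fin n × Fin n)
      few      : length edges < n
      present  : ∀ {x y} → Covered edges x y → Adj G x y
      spanning : ∀ x y → Star (Covered edges) x y

  spanningTree : Connected G → Fin n → SpanningTree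
  spanningTree c r = conclude (grow-spanning G (Connected⇒Star c) P leaf ([] ∷ []) (here refl) base)
    where
    P : List (Fin n) → Set
    P S = ∃ λ F → suc (length F) ≡ length S × (∀ {x y} → Covered F x y → Adj G x y)
                × (∀ {x y} → x ∈ S → y ∈ S → Star (Covered F) x y)
    base : P (r ∷ [])
    base = [] , refl , (λ { (inj₁ ()) ; (inj₂ ()) }) , λ { (here refl) (here refl) → ε }
    leaf : ∀ {S w v} → w ∈ S → v ∉ S → Adj G w v → P S → P (v ∷ S)
    leaf {S} {w} {v} w∈ v∉ a (F , len , pr , sp) = (w , v) ∷ F , cong suc len , pr′ , sp′
      where
      pr′ : ∀ {x y} → Covered ((w , v) ∷ F) x y → Adj G x y
      pr′ (inj₁ (here refl)) = a
      pr′ (inj₂ (here refl)) = Adj-sym G a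
      pr′ (inj₁ (there p))   = pr (inj₁ p)
      pr′ (inj₂ (there p))   = pr (inj₂ p)
      old : ∀ {x y} → x ∈ S → y ∈ S → Star (Covered ((w , v) ∷ F)) x y
      old p q = Star.map Covered-there (sp p q)
      sp′ : ∀ {x y} → x ∈ v ∷ S → y ∈ v ∷ S → Star (Covered ((w , v) ∷ F)) x y
      sp′ (here refl) (here refl) = ε
      sp′ (here refl) (there q)   = inj₂ (here refl) ◅ old w∈ q
      sp′ (there p)   (here refl) = old p w∈ ◅◅ (inj₁ (here refl) ◅ ε)
      sp′ (there p)   (there q)   = old p q
    conclude : (∃ λ S → P S × Unique S × (∀ v → v ∈ S)) → SpanningTree
    conclude (S , (F , len , pr , sp) , u , all) = record
      { edges = F ; few = subst (_≤ n) (sym len) (Unique⇒length≤ u) ; present = pr ; spanning = λ x y → sp (all x) (all y) }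

  -- n edges do not fit in a spanning tree; an edge outside it closes a tree path to a cycle.
  Unicyclic⇒Cycle : Unicyclic G → Fin n → ∃₂ λ w rs → Cycle {G = G} w rs
  Unicyclic⇒Cycle (c , count) r = conclude (any? (λ i → any? (λ j → T? (adj G i j) ×-dec ¬? (covered? i j))))
    where
    open SpanningTree (spanningTree c r)
    covered? : ∀ i j → Dec (Covered edges i j)
    covered? i j = Any.any? (Product.≡-dec _≟_ _≟_ (i , j)) edges ⊎-dec Any.any? (Product.≡-dec _≟_ _≟_ (j , i)) edges
    close : ∀ {i j} → Adj G i j → ¬ Covered edges i j →
            (∃ λ ys → Walk (Covered edges) i ys j × Unique (i ∷ ys)) → ∃ λ rs → Cycle {G = G} i rs
    -- The tree path from i to j cannot be empty since there are no loops, nor a single edge since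
    -- that edge would be covered. Hence it has at least two edges, and the uncovered edge closes it
    -- to a cycle.
    close a ¬t (_ , [] , _)            = contradiction refl (Adj-irrefl G a)
    close a ¬t (_ , t ∷ [] , _)        = contradiction t ¬t
    close a ¬t (_ , w@(_ ∷ _ ∷ _) , u) = _ , record
      { walk = Walk-map present w ; simple = u ; closing = Adj-sym G a ; long = s≤s (s≤s z≤n) }
    -- Tree edges point from the old vertex to the new one, while `edgeCount` only sees pairs with
    -- the smaller vertex first.
    order : Fin n × Fin n → Fin n × Fin n
    order (x , y) = if toℕ x <ᵇ toℕ y then (x , y) else (y , x)
    order-< : ∀ {x y} → T (toℕ x <ᵇ toℕ y) → order (x , y) ≡ (x , y)
    order-< {x} {y} p rewrite to T-≡ p = refl
    order-> : ∀ {x y} → T (toℕ x <ᵇ toℕ y) → order (y , x) ≡ (x , y)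
    order-> {x} {y} p with toℕ y <ᵇ toℕ x in eq
    ... | false = refl
    ... | true  = contradiction (<ᵇ⇒< (toℕ y) (toℕ x) (from T-≡ eq)) (<-asym (<ᵇ⇒< (toℕ x) _ p))
    Outside : Set
    Outside = ∃ λ i → ∃ λ j → Adj G i j × ¬ Covered edges i j
    all-in-tree : ¬ Outside → edgeCount G ≤ length (map order edges)
    all-in-tree none = edgeCount-≤ {G = G} λ {i} {j} l a →
      [ (λ t → subst (_∈ map order edges) (order-< (<⇒<ᵇ l)) (∈-map⁺ order t))
      , (λ t → subst (_∈ map order edges) (order-> (<⇒<ᵇ l)) (∈-map⁺ order t)) ]′
      (decidable-stable (covered? i j) (λ ¬t → none (i , j , a , ¬t)))
    conclude : Dec Outside → ∃₂ λ w rs → Cycle {G = G} w rs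
    conclude (yes (i , j , a , ¬t)) = i , close a ¬t (Star⇒simpleWalk _≟_ (spanning i j))
    conclude (no none) = contradiction (≤-trans (≤-reflexive (sym count)) (all-in-tree none))
      (<⇒≱ (subst (_< n) (sym (length-map order edges)) few))

  coreIndex-lower : Unicyclic G → Fin n →
    ∃₂ λ m k → 2 ≤ m × suc m + k ≡ n ×
      total (suc (triangular (suc m)) + triangular m) (suc (triangular (suc m))) k ≤ coreIndex G
  coreIndex-lower uni r =
    let w , rs , C = Unicyclic⇒Cycle uni r
        k , len , bound = Rich⇒coreIndex G (Connected⇒Star (proj₁ uni)) (Rich-cycle C) (Cycle.simple C) (here refl)
    in length rs , k , Cycle.long C , len , bound

-- Lists of subgraphs closed under growth

module _ {n} (G : SimpleGraph n) where

  -- The counterpart of `Rich` for upper bounds. The subgraphs through a single vertex `w` suffice,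
  -- because in the lollipop the place of the next leaf is known. Repetitions in the lists are
  -- harmless, as only their lengths matter.
  record Closed (S : Fin n → Set) (w : Fin n) (a b : ℕ) : Set where
    field
      members       : List (Sub n)
      vertices  : ∀ {v} → S v → vertex v ∈ members
      edges     : ∀ {X u v} → X ∈ members → u ∈ᵥ X → S u → S v → Adj G u v → X ⊕ (u , v) ∈ members
      inside    : ∀ {X x} → X ∈ members → x ∈ᵥ X → S x
      through   : List (Sub n)
      through⁺  : ∀ {X} → X ∈ members → w ∈ᵥ X → X ∈ through
      through⁻  : ∀ {X} → X ∈ through → X ∈ members × w ∈ᵥ X
      size-members  : length members ≡ a
      size-through  : length through ≡ b

  Closed⇒coreIndex : ∀ {S w a b} → Closed S w a b → (∀ x → S x) → coreIndex G ≤ a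
  Closed⇒coreIndex C s = subst (coreIndex G ≤_) (Closed.size-members C) (coreIndex-≤ mem)
    where
    mem : ∀ {X} → Grown G X → X ∈ Closed.members C
    mem (start v)                 = Closed.vertices C (s v)
    mem (extend {u = u} {v} g u∈ a) = Closed.edges C (mem g) u∈ (s u) (s v) a

  -- The only edge at `v` is `wv`. An edge added to a member is therefore either `wv` itself, which
  -- yields a new member or is already present, or an edge inside `S`, which can be added before
  -- `wv`.
  Closed-leaf : ∀ {S S′ : Fin n → Set} {w v a b} → S w → ¬ S v → (∀ {x} → S x → Adj G x v → x ≡ w) →
                (∀ {x} → S′ x → S x ⊎ x ≡ v) → (∀ {x} → S x → S′ x) → S′ v →
                Closed S w a b → Closed S′ v (a + suc b) (suc b)
  Closed-leaf {S} {S′} {w} {v} {a} {b} Sw ¬Sv leaf S′⁻ S⊆S′ S′v C = record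
    { members      = members ++ new
    ; vertices = λ s → [ (λ s → ∈-++⁺ˡ (vertices s)) , (λ { refl → ∈-++⁺ʳ members (here refl) }) ]′ (S′⁻ s)
    ; edges    = edges′
    ; inside   = inside′
    ; through  = new
    ; through⁺ = λ X∈ v∈ → [ (λ p → contradiction (inside p v∈) ¬Sv) , id ]′ (∈-++⁻ members X∈)
    ; through⁻ = λ X∈ → ∈-++⁺ʳ members X∈ , v∈new X∈
    ; size-members = trans (length-++ members) (cong₂ _+_ size-members size-new)
    ; size-through = size-new
    }
    where
    open Closed C
    new : List (Sub n)
    new = vertex v ∷ map (_⊕ (w , v)) through
    size-new : length new ≡ suc b
    size-new = cong suc (trans (length-map _ through) size-through)
    v∈new : ∀ {X} → X ∈ new → v ∈ᵥ X
    v∈new (here refl) = ∈ᵥ-vertex⁺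
    v∈new (there p) with ∈-map⁻ (_⊕ (w , v)) p
    ... | Y , _ , refl = ⊕ᵥʳ
    new⁺ : ∀ {Y} → Y ∈ through → Y ⊕ (w , v) ∈ members ++ new
    new⁺ p = ∈-++⁺ʳ members (there (∈-map⁺ (_⊕ (w , v)) p))
    inside′ : ∀ {X x} → X ∈ members ++ new → x ∈ᵥ X → S′ x
    inside′ X∈ x∈ with ∈-++⁻ members X∈
    ... | inj₁ p           = S⊆S′ (inside p x∈)
    ... | inj₂ (here refl) = subst S′ (sym (∈ᵥ-vertex⁻ x∈)) S′v
    ... | inj₂ (there p) with ∈-map⁻ (_⊕ (w , v)) p
    ...   | Y , q , refl with ∈ᵥ-⊕⁻ x∈
    ...     | inj₁ r           = S⊆S′ (inside (proj₁ (through⁻ q)) r)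
    ...     | inj₂ (inj₁ refl) = S⊆S′ Sw
    ...     | inj₂ (inj₂ refl) = S′v
    edges′ : ∀ {X u t} → X ∈ members ++ new → u ∈ᵥ X → S′ u → S′ t → Adj G u t → X ⊕ (u , t) ∈ members ++ new
    edges′ {X} {u} {t} X∈ u∈ Su St adj-ut with ∈-++⁻ members X∈ | S′⁻ St
    ... | inj₁ p | inj₁ s    = ∈-++⁺ˡ (edges p u∈ (inside p u∈) s adj-ut)
    ... | inj₁ p | inj₂ refl with leaf (inside p u∈) adj-ut
    ...   | refl = new⁺ (through⁺ p u∈)
    edges′ X∈ u∈ Su St adj-ut | inj₂ (here refl) | t? with ∈ᵥ-vertex⁻ u∈ | t?
    ...   | refl | inj₂ refl = contradiction refl (Adj-irrefl G adj-ut)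
    ...   | refl | inj₁ s with leaf s (Adj-sym G adj-ut)
    -- Growing the lone vertex `v` towards `w` gives the same subgraph as growing the lone vertex
    -- `w` towards `v`, and the latter comes from `through`.
    ...     | refl = subst (_∈ members ++ new) vertex-⊕-swap (new⁺ (through⁺ (vertices Sw) ∈ᵥ-vertex⁺))
    edges′ {u = u} {t} X∈ u∈ Su St adj-ut | inj₂ (there p) | t? with ∈-map⁻ (_⊕ (w , v)) p | S′⁻ Su | t?
    ...   | Y , q , refl | inj₂ refl | inj₂ refl = contradiction refl (Adj-irrefl G adj-ut)
    ...   | Y , q , refl | inj₂ refl | inj₁ s with leaf s (Adj-sym G adj-ut)
    ...     | refl = subst (_∈ members ++ new) (sym (⊕-absorb (HasEdge-swap HasEdge-⊕))) (new⁺ q)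
    edges′ {u = u} {t} X∈ u∈ Su St adj-ut | inj₂ (there p) | t? | Y , q , refl | inj₁ s | inj₂ refl with leaf s adj-ut
    ...     | refl = subst (_∈ members ++ new) (sym (⊕-absorb HasEdge-⊕)) (new⁺ q)
    edges′ {u = u} {t} X∈ u∈ Su St adj-ut | inj₂ (there p) | t? | Y , q , refl | inj₁ su | inj₁ st =
      -- The edge is first added to `Y`, which keeps it a member through `w`, and then `wv` is
      -- added.
      subst (_∈ members ++ new) ⊕-comm (new⁺ (through⁺ (edges (proj₁ (through⁻ q)) u∈Y su st adj-ut)
        (⊑ᵥ ⊑-⊕ (proj₂ (through⁻ q)))))
      where
      u∈Y : u ∈ᵥ Y
      u∈Y with ∈ᵥ-⊕⁻ u∈
      ... | inj₁ r           = r
      ... | inj₂ (inj₁ refl) = proj₂ (through⁻ q)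
      ... | inj₂ (inj₂ refl) = contradiction su ¬Sv

-- The lollipop

empty : ∀ {n} → Sub n
empty = mkSub (λ _ → false) (λ _ _ → false)

∉ᵥ-empty : ∀ {n} {x : Fin n} → ¬ x ∈ᵥ empty
∉ᵥ-empty {x = x} (mkᵥ p) = subst T (hasV-mkSub (λ _ → false) (λ _ _ → false) x) p

empty-⊑ : ∀ {n} {X : Sub n} → empty ⊑ X
empty-⊑ = (λ p → ⊥-elim (∉ᵥ-empty p)) ,
  (λ { {x , y} (mkₑ p) → ⊥-elim (subst T (hasE-mkSub (λ _ → false) (λ _ _ → false) x y) p) })

vertex-⊕ : ∀ {n} {u v : Fin n} → vertex u ⊕ (u , v) ≡ empty ⊕ (u , v)
vertex-⊕ = ⊑-antisym (⊕-least (vertex-⊑ ⊕ᵥˡ) HasEdge-⊕) (⊕-least empty-⊑ HasEdge-⊕)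

addIf : ∀ {n} → Bool → Fin n × Fin n → Sub n → Sub n
addIf b e X = if b then X ⊕ e else X

addIf-⊕ : ∀ {n} b {e f} {X : Sub n} → addIf b e X ⊕ f ≡ addIf b e (X ⊕ f)
addIf-⊕ true  = ⊕-comm
addIf-⊕ false = refl

addIf-absorb : ∀ {n} b {e} {X : Sub n} → addIf b e X ⊕ e ≡ X ⊕ e
addIf-absorb true  = ⊕-absorb HasEdge-⊕
addIf-absorb false = refl

∈ᵥ-addIf⁻ : ∀ {n} b {u v x} {X : Sub n} → x ∈ᵥ addIf b (u , v) X → x ∈ᵥ X ⊎ x ≡ u ⊎ x ≡ v
∈ᵥ-addIf⁻ true  = ∈ᵥ-⊕⁻
∈ᵥ-addIf⁻ false = inj₁

module Triangle (k : ℕ) (G : SimpleGraph (3 + k)) where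

  v₀ v₁ v₂ : Fin (3 + k)
  v₀ = zero
  v₁ = suc zero
  v₂ = suc (suc zero)

  -- The bits select the edges 01, 02 and 12. Building on `empty` rather than on a vertex gives each
  -- edge set one normal form, whichever vertex the growth began with.
  tri : Bool × Bool × Bool → Sub (3 + k)
  tri (a , b , c) = addIf a (v₀ , v₁) (addIf b (v₀ , v₂) (addIf c (v₁ , v₂) empty))

  tri-01 : ∀ a b c → tri (a , b , c) ⊕ (v₀ , v₁) ≡ tri (true , b , c)
  tri-01 a b c = addIf-absorb a

  tri-02 : ∀ a b c → tri (a , b , c) ⊕ (v₀ , v₂) ≡ tri (a , true , c)
  tri-02 a b c = trans (addIf-⊕ a) (cong (addIf a _) (addIf-absorb b))

  tri-12 : ∀ a b c → tri (a , b , c) ⊕ (v₁ , v₂) ≡ tri (a , b , true)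
  tri-12 a b c = trans (addIf-⊕ a) (cong (addIf a _) (trans (addIf-⊕ b) (cong (addIf b _) (addIf-absorb c))))

  masks₂ masks : List (Bool × Bool × Bool)
  masks₂ = (false , true , false) ∷ (false , false , true) ∷ (false , true , true) ∷
           (true , true , false) ∷ (true , false , true) ∷ (true , true , true) ∷ []
  masks  = (true , false , false) ∷ masks₂

  has01 : ∀ b c → (true , b , c) ∈ masks
  has01 false false = here refl
  has01 true  false = there (there (there (there (here refl))))
  has01 false true  = there (there (there (there (there (here refl)))))
  has01 true  true  = there (there (there (there (there (there (here refl))))))

  has02 : ∀ a c → (a , true , c) ∈ masks
  has02 false false = there (here refl)
  has02 false true  = there (there (there (here refl)))
  has02 true  c     = has01 true c

  has12 : ∀ a b → (a , b , true) ∈ masks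
  has12 false false = there (there (here refl))
  has12 false true  = has02 false true
  has12 true  b     = has01 b true

  singles all₀ through₀ : List (Sub (3 + k))
  singles  = vertex v₀ ∷ vertex v₁ ∷ vertex v₂ ∷ []
  all₀     = singles ++ map tri masks
  through₀ = vertex v₂ ∷ map tri masks₂

  mask∈ : ∀ {m} → m ∈ masks → tri m ∈ all₀
  mask∈ p = ∈-++⁺ʳ singles (∈-map⁺ tri p)

  S : Fin (3 + k) → Set
  S x = toℕ x < 3

  edge-tri : ∀ {m u v} → S u → S v → u ≢ v → tri m ⊕ (u , v) ∈ all₀
  edge-tri {a , b , c} {zero} {zero} _ _ ne = contradiction refl ne
  edge-tri {a , b , c} {zero} {suc zero} _ _ ne = subst (_∈ all₀) (sym (tri-01 a b c)) (mask∈ (has01 b c))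
  edge-tri {a , b , c} {zero} {suc (suc zero)} _ _ ne = subst (_∈ all₀) (sym (tri-02 a b c)) (mask∈ (has02 a c))
  edge-tri {a , b , c} {suc zero} {zero} _ _ ne = subst (_∈ all₀) (sym (trans ⊕-swap (tri-01 a b c))) (mask∈ (has01 b c))
  edge-tri {a , b , c} {suc zero} {suc zero} _ _ ne = contradiction refl ne
  edge-tri {a , b , c} {suc zero} {suc (suc zero)} _ _ ne = subst (_∈ all₀) (sym (tri-12 a b c)) (mask∈ (has12 a b))
  edge-tri {a , b , c} {suc (suc zero)} {zero} _ _ ne = subst (_∈ all₀) (sym (trans ⊕-swap (tri-02 a b c))) (mask∈ (has02 a c))
  edge-tri {a , b , c} {suc (suc zero)} {suc zero} _ _ ne = subst (_∈ all₀) (sym (trans ⊕-swap (tri-12 a b c))) (mask∈ (has12 a b))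
  edge-tri {a , b , c} {suc (suc zero)} {suc (suc zero)} _ _ ne = contradiction refl ne
  edge-tri {u = suc (suc (suc _))} (s≤s (s≤s (s≤s ())))
  edge-tri {v = suc (suc (suc _))} _ (s≤s (s≤s (s≤s ())))

  singles⁻ : ∀ {X} → X ∈ singles → ∃ λ i → X ≡ vertex i × S i
  singles⁻ (here refl)                 = v₀ , refl , s≤s z≤n
  singles⁻ (there (here refl))         = v₁ , refl , s≤s (s≤s z≤n)
  singles⁻ (there (there (here refl))) = v₂ , refl , s≤s (s≤s (s≤s z≤n))

  vertices₀ : ∀ {v} → S v → vertex v ∈ all₀
  vertices₀ {zero}             _ = here refl
  vertices₀ {suc zero}         _ = there (here refl)
  vertices₀ {suc (suc zero)}   _ = there (there (here refl))
  vertices₀ {suc (suc (suc _))} (s≤s (s≤s (s≤s ())))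

  edges₀ : ∀ {X u v} → X ∈ all₀ → u ∈ᵥ X → S u → S v → Adj G u v → X ⊕ (u , v) ∈ all₀
  edges₀ X∈ u∈ Su Sv a with ∈-++⁻ singles X∈
  ... | inj₂ p with ∈-map⁻ tri {xs = masks} p
  ...   | m , _ , refl = edge-tri {m} Su Sv (Adj-irrefl G a)
  edges₀ X∈ u∈ Su Sv a | inj₁ p with singles⁻ p
  ...   | i , refl , _ with ∈ᵥ-vertex⁻ u∈
  ...     | refl = subst (_∈ all₀) (sym vertex-⊕) (edge-tri {false , false , false} Su Sv (Adj-irrefl G a))

  ends : ∀ b {u v x X} → S u → S v → (x ∈ᵥ X → S x) → x ∈ᵥ addIf b (u , v) X → S x
  ends b Su Sv h p with ∈ᵥ-addIf⁻ b p
  ... | inj₁ q           = h q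
  ... | inj₂ (inj₁ refl) = Su
  ... | inj₂ (inj₂ refl) = Sv

  inside₀ : ∀ {X x} → X ∈ all₀ → x ∈ᵥ X → S x
  inside₀ X∈ x∈ with ∈-++⁻ singles X∈
  ... | inj₁ p with singles⁻ p
  ...   | i , refl , Si = subst S (sym (∈ᵥ-vertex⁻ x∈)) Si
  inside₀ X∈ x∈ | inj₂ p with ∈-map⁻ tri {xs = masks} p
  ...   | (a , b , c) , _ , refl =
    ends a S₀ S₁ (ends b S₀ S₂ (ends c S₁ S₂ (⊥-elim ∘ ∉ᵥ-empty))) x∈
    where
    S₀ : S v₀
    S₀ = s≤s z≤n
    S₁ : S v₁
    S₁ = s≤s (s≤s z≤n)
    S₂ : S v₂
    S₂ = s≤s (s≤s (s≤s z≤n))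

  through₀⁺ : ∀ {X} → X ∈ all₀ → v₂ ∈ᵥ X → X ∈ through₀
  through₀⁺ (here refl)                 p with () ← ∈ᵥ-vertex⁻ p
  through₀⁺ (there (here refl))         p with () ← ∈ᵥ-vertex⁻ p
  through₀⁺ (there (there (here refl))) p = here refl
  through₀⁺ (there (there (there (here refl)))) p with ∈ᵥ-⊕⁻ p
  ... | inj₁ q         = contradiction q ∉ᵥ-empty
  ... | inj₂ (inj₁ ())
  ... | inj₂ (inj₂ ())
  through₀⁺ (there (there (there (there q)))) p = there q

  v₂∈ : ∀ m → m ∈ masks₂ → v₂ ∈ᵥ tri m
  v₂∈ _ (here refl) = ⊕ᵥʳ
  v₂∈ _ (there (here refl)) = ⊕ᵥʳ
  v₂∈ _ (there (there (here refl))) = ⊕ᵥʳ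
  v₂∈ _ (there (there (there (here refl)))) = ⊑ᵥ ⊑-⊕ ⊕ᵥʳ
  v₂∈ _ (there (there (there (there (here refl))))) = ⊑ᵥ ⊑-⊕ ⊕ᵥʳ
  v₂∈ _ (there (there (there (there (there (here refl)))))) = ⊑ᵥ ⊑-⊕ ⊕ᵥʳ

  through₀⁻ : ∀ {X} → X ∈ through₀ → X ∈ all₀ × v₂ ∈ᵥ X
  through₀⁻ (here refl) = there (there (here refl)) , ∈ᵥ-vertex⁺
  through₀⁻ (there p) with ∈-map⁻ tri {xs = masks₂} p
  ... | m , q , refl = mask∈ (there q) , v₂∈ m q

  -- Every nonempty set of edges of a triangle is connected, so there are 3 + 7 = 10 members.
  -- Through `v₂` there are the vertex itself and all edge sets except the one consisting of 01
  -- alone, which makes 1 + 6 = 7.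
  Closed-triangle : Closed G S v₂ 10 7
  Closed-triangle = record
    { members = all₀ ; vertices = vertices₀ ; edges = edges₀ ; inside = inside₀
    ; through = through₀ ; through⁺ = through₀⁺ ; through⁻ = through₀⁻ ; size-members = refl ; size-through = refl }

-- The edges of the lollipop, and its path added leaf by leaf

mkGraph-adj⁻ : ∀ {n} (b : Fin n → Fin n → Bool) {i j} → Adj (mkGraph b) i j → T (b i j) ⊎ T (b j i)
mkGraph-adj⁻ b {i} {j} a = to (T-∨ {b i j}) (proj₂ (to (T-∧ {not ⌊ i ≟ j ⌋}) a))

lollipopLink : ∀ {n} → Fin n → Fin n → Bool
lollipopLink i j = ((toℕ i <ᵇ 3) ∧ (toℕ j <ᵇ 3)) ∨ ((2 ≤ᵇ toℕ i) ∧ (suc (toℕ i) ≡ᵇ toℕ j))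

lollipopLink⁻ : ∀ {n} (i j : Fin n) → T (lollipopLink i j) → (toℕ i < 3 × toℕ j < 3) ⊎ suc (toℕ i) ≡ toℕ j
lollipopLink⁻ i j p with to (T-∨ {(toℕ i <ᵇ 3) ∧ (toℕ j <ᵇ 3)}) p
... | inj₁ q = let r , s = to (T-∧ {toℕ i <ᵇ 3}) q in inj₁ (<ᵇ⇒< (toℕ i) 3 r , <ᵇ⇒< (toℕ j) 3 s)
... | inj₂ q = inj₂ (≡ᵇ⇒≡ _ (toℕ j) (proj₂ (to (T-∧ {2 ≤ᵇ toℕ i}) q)))

module _ (k : ℕ) where

  private
    n = 3 + k
    G = lollipop n

  lollipop-leaf : ∀ j {x v : Fin n} → toℕ v ≡ 3 + j → toℕ x < 3 + j → Adj G x v → toℕ x ≡ 2 + j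
  lollipop-leaf j {x} {v} eq x< a =
    [ (λ p → [ (λ (_ , v<3) → contradiction v<3 v≮3) , (λ q → suc-injective (trans q eq)) ]′ (lollipopLink⁻ x v p))
    , (λ p → [ (λ (v<3 , _) → contradiction v<3 v≮3)
             , (λ q → contradiction (≤-reflexive q) (<-asym (subst (toℕ x <_) (sym eq) x<))) ]′ (lollipopLink⁻ v x p))
    ]′ (mkGraph-adj⁻ lollipopLink {x} {v} a)
    where
    v≮3 : ¬ toℕ v < 3
    v≮3 = ≤⇒≯ (subst (3 ≤_) (sym eq) (m≤m+n 3 j))

  Closed-lollipop : ∀ j (lt : 2 + j < n) → Closed G (λ x → toℕ x < 3 + j) (fromℕ< lt) (total 10 7 j) (7 + j)
  Closed-lollipop zero    lt = Triangle.Closed-triangle k G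
  Closed-lollipop (suc j) lt = subst (Closed G _ _ _) (sym (+-suc 7 j))
    (Closed-leaf G
      (subst (_< 3 + j) (sym (toℕ-fromℕ< lt′)) ≤-refl)
      (λ p → <-irrefl (toℕ-fromℕ< lt) p)
      (λ x< a → toℕ-injective (trans (lollipop-leaf j (toℕ-fromℕ< lt) x< a) (sym (toℕ-fromℕ< lt′))))
      (λ x< → [ inj₁ , (λ eq → inj₂ (toℕ-injective (trans eq (sym (toℕ-fromℕ< lt))))) ]′ (m≤n⇒m<n∨m≡n (s≤s⁻¹ x<)))
      m<n⇒m<1+n
      (subst (_< 4 + j) (sym (toℕ-fromℕ< lt)) ≤-refl)
      (Closed-lollipop j lt′))
    where
    lt′ : 2 + j < n
    lt′ = <-trans (n<1+n _) lt

  coreIndex-lollipop : coreIndex G ≤ total 10 7 k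
  coreIndex-lollipop = Closed⇒coreIndex G (Closed-lollipop k ≤-refl) toℕ<n

-- Small cycles

_≟ˢ_ : ∀ {n} → DecidableEquality (Sub n)
_≟ˢ_ = Product.≡-dec (Vecₚ.≡-dec Bool._≟_) (Vecₚ.≡-dec (Vecₚ.≡-dec Bool._≟_))

_∈ˢ?_ : ∀ {n} (X : Sub n) L → Dec (X ∈ L)
X ∈ˢ? L = Any.any? (X ≟ˢ_) L

-- A test that can be run: for the cycles of length 4, 5 and 6 it inspects 17, 26 and 37 subgraphs,
-- each with all pairs of vertices.
closedB : ∀ {n} → SimpleGraph n → List (Sub n) → Bool
closedB G L = allV (λ v → ⌊ vertex v ∈ˢ? L ⌋)
            ∧ all (λ X → allV (λ u → allV (λ v → not (hasV X u ∧ adj G u v) ∨ ⌊ (X ⊕ (u , v)) ∈ˢ? L ⌋))) L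

closedB⇒coreIndex : ∀ {n} {G : SimpleGraph n} L → T (closedB G L) → coreIndex G ≤ length L
closedB⇒coreIndex {n} {G} L h = coreIndex-≤ mem
  where
  parts = to (T-∧ {allV (λ v → ⌊ vertex v ∈ˢ? L ⌋)}) h
  test : Sub n → Fin n → Fin n → Bool
  test X u v = not (hasV X u ∧ adj G u v) ∨ ⌊ (X ⊕ (u , v)) ∈ˢ? L ⌋
  mem : ∀ {X} → Grown G X → X ∈ L
  mem (start v) = toWitness (allV⁻ {p = λ v → ⌊ vertex v ∈ˢ? L ⌋} (proj₁ parts) v)
  mem (extend {X} {u} {v} g u∈ a) = toWitness {a? = (X ⊕ (u , v)) ∈ˢ? L}
    (⇒⁻ {hasV X u ∧ adj G u v}
      (allV⁻ {p = test X u} (allV⁻ {p = λ u → allV (test X u)} (All.lookup (all⁺ _ L (proj₂ parts)) (mem g)) u) v)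
      (from T-∧ (bitᵥ u∈ , a)))

next : ∀ {m} → Fin (suc m) → Fin (suc m)
next {m} i = suc (toℕ i) mod suc m

arcsFrom : ∀ {m} → ℕ → Sub (suc m) → Fin (suc m) → List (Sub (suc m))
arcsFrom zero    X u = []
arcsFrom (suc j) X u = X ∷ arcsFrom j (X ⊕ (u , next u)) (next u)

-- The full cycle, and from each of the m + 1 starting vertices the arcs with 0 to m edges in the
-- direction of `next`, hence (m + 1)² + 1 entries.
arcs : ∀ m → List (Sub (suc m))
arcs m = foldr (λ u X → X ⊕ (u , next u)) empty (allFin (suc m))
       ∷ concatMap (λ s → arcsFrom (suc m) (vertex s) s) (allFin (suc m))

ArcsClosed : ℕ → Set
ArcsClosed m = closedB (cycleGraph (suc m)) (arcs m) ≡ true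

-- The order is a variable n on purpose: comparing two core indices at numerals would evaluate them.
coreIndex-cycle-≤ : ∀ {n m k} → n ≡ suc m → length (arcs m) ≡ k → ArcsClosed m → coreIndex (cycleGraph n) ≤ k
coreIndex-cycle-≤ {m = m} refl refl h = closedB⇒coreIndex {G = cycleGraph (suc m)} (arcs m) (from T-≡ h)

opaque
  unfolding vertex _⊕_

  arcsClosed₃ : ArcsClosed 3
  arcsClosed₃ = refl

  arcsClosed₄ : ArcsClosed 4
  arcsClosed₄ = refl

  arcsClosed₅ : ArcsClosed 5
  arcsClosed₅ = refl

coreIndex-cycle₄ : ∀ {n} → n ≡ 4 → coreIndex (cycleGraph n) ≤ 17
coreIndex-cycle₄ eq = coreIndex-cycle-≤ {m = 3} eq refl arcsClosed₃

coreIndex-cycle₅ : ∀ {n} → n ≡ 5 → coreIndex (cycleGraph n) ≤ 26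
coreIndex-cycle₅ eq = coreIndex-cycle-≤ {m = 4} eq refl arcsClosed₄

coreIndex-cycle₆ : ∀ {n} → n ≡ 6 → coreIndex (cycleGraph n) ≤ 37
coreIndex-cycle₆ eq = coreIndex-cycle-≤ {m = 5} eq refl arcsClosed₅

-- Paths with a chord

mkGraph-adj⁺ : ∀ {n} (b : Fin n → Fin n → Bool) {i j} → i ≢ j → T (b i j) → Adj (mkGraph b) i j
mkGraph-adj⁺ b {i} {j} ne p with i ≟ j
... | yes eq = contradiction eq ne
... | no  _  = from T-∨ (inj₁ p)

-- Both extremal graphs are the path 0, 1, ..., m with one chord from 0: to 2 for the lollipop and
-- to the last vertex for the cycle. As the chord ends at 2 or later, it is not an edge of the path,
-- and there are m + 1 edges.
module _ {m} (G : SimpleGraph (suc m)) (c : Fin (suc m)) (2≤c : 2 ≤ toℕ c)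
         (edge⁻ : ∀ {i j} → toℕ i < toℕ j → Adj G i j → toℕ j ≡ suc (toℕ i) ⊎ (toℕ i ≡ 0 × toℕ j ≡ toℕ c))
         (path : ∀ {i j} → toℕ j ≡ suc (toℕ i) → Adj G i j)
         (chord : Adj G zero c) where

  private
    pathEdge : Fin m → Fin (suc m) × Fin (suc m)
    pathEdge i = inject₁ i , suc i

    edgeList : List (Fin (suc m) × Fin (suc m))
    edgeList = (zero , c) ∷ map pathEdge (allFin m)

    edgeList-unique : Unique edgeList
    edgeList-unique = ¬Any⇒All¬ _ fresh ∷ Uniq.map⁺ (λ eq → Fin.suc-injective (cong proj₂ eq)) (Uniq.allFin⁺ m)
      where
      fresh : (zero , c) ∉ map pathEdge (allFin m)
      fresh p with ∈-map⁻ pathEdge p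
      ... | zero  , _ , refl = contradiction 2≤c λ { (s≤s ()) }
      ... | suc _ , _ , ()

    length-edgeList : length edgeList ≡ suc m
    length-edgeList = cong suc (trans (length-map pathEdge (allFin m)) (length-tabulate {n = m} id))

    ∈-edgeList : ∀ {i j} → toℕ i < toℕ j → Adj G i j → (i , j) ∈ edgeList
    ∈-edgeList {i} {j} lt a with edge⁻ lt a
    ... | inj₂ (p , q) = here (cong₂ _,_ (toℕ-injective p) (toℕ-injective q))
    ∈-edgeList {i} {suc j} lt a | inj₁ p = there (subst (λ k → (k , suc j) ∈ map pathEdge (allFin m))
      (toℕ-injective (trans (toℕ-inject₁ j) (cong pred p))) (∈-map⁺ pathEdge (∈-allFin j)))

    edgeList⁻ : ∀ {i j} → (i , j) ∈ edgeList → toℕ i < toℕ j × Adj G i j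
    edgeList⁻ (here refl) = ≤-trans (s≤s z≤n) 2≤c , chord
    edgeList⁻ (there p) with ∈-map⁻ pathEdge p
    ... | j , _ , refl = ≤-reflexive (cong suc (toℕ-inject₁ j)) , path (cong suc (sym (toℕ-inject₁ j)))

    count : edgeCount G ≡ suc m
    count = ≤-antisym
      (subst (edgeCount G ≤_) length-edgeList (edgeCount-≤ {G = G} ∈-edgeList))
      (subst (_≤ edgeCount G) length-edgeList (edgeCount-≥ {G = G} edgeList-unique edgeList⁻))

    from-zero : ∀ i → Star (Adj G) zero i
    from-zero = <-weakInduction (Star (Adj G) zero) ε
      (λ i s → s ◅◅ (path (cong suc (sym (toℕ-inject₁ i))) ◅ ε))

  chordedPath-unicyclic : Unicyclic G
  chordedPath-unicyclic = to T-≡ (connectedB⁺ {V = λ _ → true} λ u v _ _ →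
    Star.map (_ ,_) (Star.reverse (Adj-sym G) (from-zero u) ◅◅ from-zero v)) , count

lollipop-unicyclic : ∀ {n} → 3 ≤ n → Unicyclic (lollipop n)
lollipop-unicyclic (s≤s (s≤s (s≤s {n = k} _))) = chordedPath-unicyclic (lollipop n) (suc (suc zero)) ≤-refl edge⁻
  (λ {i} {j} eq → mkGraph-adj⁺ lollipopLink {i} {j} (λ { refl → 1+n≢n (sym eq) }) (consecutive (toℕ i) (toℕ j) eq))
  _
  where
  n = 3 + k
  small : ∀ {x y} → x < y → y < 3 → y ≡ suc x ⊎ (x ≡ 0 × y ≡ 2)
  small {zero}        {suc zero}          _ _ = inj₁ refl
  small {zero}        {suc (suc zero)}    _ _ = inj₂ (refl , refl)
  small {suc zero}    {suc (suc zero)}    _ _ = inj₁ refl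
  small {suc _}       {suc zero}          (s≤s ())
  small {suc (suc _)} {suc (suc zero)}    (s≤s (s≤s ()))
  small {_}           {suc (suc (suc _))} _ (s≤s (s≤s (s≤s ())))
  edge⁻ : ∀ {i j} → toℕ i < toℕ j → Adj (lollipop n) i j → toℕ j ≡ suc (toℕ i) ⊎ (toℕ i ≡ 0 × toℕ j ≡ 2)
  edge⁻ {i} {j} lt a with mkGraph-adj⁻ lollipopLink {i} {j} a
  ... | inj₁ p = [ (λ (_ , q) → small lt q) , inj₁ ∘ sym ]′ (lollipopLink⁻ i j p)
  ... | inj₂ p = [ (λ (q , _) → small lt q) , (λ q → contradiction (≤-reflexive q) (<-asym lt)) ]′ (lollipopLink⁻ j i p)
  consecutive : ∀ x y → y ≡ suc x → T (((x <ᵇ 3) ∧ (y <ᵇ 3)) ∨ ((2 ≤ᵇ x) ∧ (suc x ≡ᵇ y)))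
  consecutive zero          _ refl = _
  consecutive (suc zero)    _ refl = _
  consecutive (suc (suc x)) y eq   = from (T-∨ {(2 + x <ᵇ 3) ∧ (y <ᵇ 3)}) (inj₂ (≡⇒≡ᵇ (3 + x) y (sym eq)))

cycle-unicyclic : ∀ {n} → 3 ≤ n → Unicyclic (cycleGraph n)
cycle-unicyclic (s≤s (s≤s (s≤s {n = k} _))) = chordedPath-unicyclic (cycleGraph n) last
  (subst (2 ≤_) (sym (toℕ-fromℕ (2 + k))) (s≤s (s≤s z≤n))) edge⁻
  (λ {i} {j} eq → mkGraph-adj⁺ link {i} {j} (λ { refl → 1+n≢n (sym eq) })
    (from T-∨ (inj₁ (≡⇒≡ᵇ (suc (toℕ i)) (toℕ j) (sym eq)))))
  (mkGraph-adj⁺ link {zero} {last} (λ ())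
    (from (T-∨ {1 ≡ᵇ toℕ last}) (inj₂ (≡⇒≡ᵇ (suc (toℕ last)) n (cong suc (toℕ-fromℕ (2 + k)))))))
  where
  n = 3 + k
  link : Fin n → Fin n → Bool
  link i j = (suc (toℕ i) ≡ᵇ toℕ j) ∨ ((toℕ i ≡ᵇ 0) ∧ (suc (toℕ j) ≡ᵇ n))
  last : Fin n
  last = fromℕ (2 + k)
  link⁻ : ∀ i j → T (link i j) → suc (toℕ i) ≡ toℕ j ⊎ (toℕ i ≡ 0 × toℕ j ≡ toℕ last)
  link⁻ i j p with to (T-∨ {suc (toℕ i) ≡ᵇ toℕ j}) p
  ... | inj₁ q = inj₁ (≡ᵇ⇒≡ _ (toℕ j) q)
  ... | inj₂ q = let r , s = to (T-∧ {toℕ i ≡ᵇ 0}) q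
                 in inj₂ (≡ᵇ⇒≡ (toℕ i) 0 r , trans (cong pred (≡ᵇ⇒≡ (suc (toℕ j)) n s)) (sym (toℕ-fromℕ (2 + k))))
  edge⁻ : ∀ {i j} → toℕ i < toℕ j → Adj (cycleGraph n) i j → toℕ j ≡ suc (toℕ i) ⊎ (toℕ i ≡ 0 × toℕ j ≡ toℕ last)
  edge⁻ {i} {j} lt a with mkGraph-adj⁻ link {i} {j} a
  ... | inj₁ p = [ inj₁ ∘ sym , inj₂ ]′ (link⁻ i j p)
  ... | inj₂ p = [ (λ q → contradiction (≤-reflexive q) (<-asym lt))
                 , (λ (q , _) → contradiction (subst (toℕ i <_) q lt) λ ()) ]′ (link⁻ j i p)

-- Comparing the bounds

total-+ : ∀ a b d k → total a b (d + k) ≡ total (total a b d) (b + d) k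
total-+ a b d zero    = cong (total a b) (+-identityʳ d)
total-+ a b d (suc k) = trans (cong (total a b) (+-suc d k))
  (cong₂ (λ x y → x + suc y) (total-+ a b d k) (sym (+-assoc b d k)))

total-mono : ∀ {a a′ b b′} k → a ≤ a′ → b ≤ b′ → total a b k ≤ total a′ b′ k
total-mono zero    p q = p
total-mono (suc k) p q = +-mono-≤ (total-mono k p q) (s≤s (+-monoˡ-≤ k q))

-- The numbers of connected subgraphs of a cycle of length d + 3, in total and through a vertex.
arcs-all arcs-through : ℕ → ℕ
arcs-all d     = suc (triangular (3 + d)) + triangular (2 + d)
arcs-through d = suc (triangular (3 + d))

arcs-through-≥ : ∀ d → 7 + d ≤ arcs-through d
arcs-through-≥ zero    = ≤-refl
arcs-through-≥ (suc d) = s≤s (≤-trans (arcs-through-≥ d) (s≤s (m≤n+m (triangular (3 + d)) (3 + d))))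

-- Both sides are 37 for e = 0. When e increases by one, the lollipop gains 11 + e while the cycle
-- gains (7 + e)² - (6 + e)² = 13 + 2e.
arcs-all-≥ : ∀ e → total 10 7 (3 + e) ≤ arcs-all (3 + e)
arcs-all-≥ zero    = ≤-refl
arcs-all-≥ (suc e) = begin
  total 10 7 (3 + e) + suc (7 + (3 + e))             ≤⟨ +-mono-≤ (arcs-all-≥ e) (m≤m+n (11 + e) (2 + e)) ⟩
  arcs-all (3 + e) + (11 + e + (2 + e))              ≡⟨ solve 3 (λ s t e → (con 1 :+ s :+ t) :+ (con 11 :+ e :+ (con 2 :+ e)) :=
                                                          (con 1 :+ ((con 7 :+ e) :+ s)) :+ ((con 6 :+ e) :+ t)) refl
                                                          (triangular (6 + e)) (triangular (5 + e)) e ⟩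
  arcs-all (4 + e)                                   ∎
  where
  open ≤-Reasoning
  open +-*-Solver

-- Both sides are moved to a common order at which the pairs compare entrywise, and `total-mono`
-- does the rest. For d = 1 and d = 2 this takes one leaf on the cycle: (27 , 9) against (29 , 12),
-- and (37 , 10) against (43 , 17).
total-lollipop-≤ : ∀ d k → 3 ≤ d + k → total 10 7 (d + k) ≤ total (arcs-all d) (arcs-through d) k
total-lollipop-≤ 0 k _ = ≤-refl
total-lollipop-≤ 1 zero (s≤s ())
total-lollipop-≤ 1 (suc k) _ = subst₂ _≤_ (sym (total-+ 10 7 2 k)) (sym (total-+ (arcs-all 1) (arcs-through 1) 1 k))
  (total-mono k (m≤m+n 27 2) (m≤m+n 9 3))
total-lollipop-≤ 2 zero (s≤s (s≤s ()))
total-lollipop-≤ 2 (suc k) _ = subst₂ _≤_ (sym (total-+ 10 7 3 k)) (sym (total-+ (arcs-all 2) (arcs-through 2) 1 k))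
  (total-mono k (m≤m+n 37 6) (m≤m+n 10 7))
total-lollipop-≤ (suc (suc (suc e))) k _ = subst (_≤ total (arcs-all (3 + e)) (arcs-through (3 + e)) k)
  (sym (total-+ 10 7 (3 + e) k)) (total-mono k (arcs-all-≥ e) (arcs-through-≥ (3 + e)))

-- The possible values are 18 for the triangle with a leaf and 17 for C₄.
total-≥-17 : ∀ d k → d + k ≡ 1 → 17 ≤ total (arcs-all d) (arcs-through d) k
total-≥-17 0 _ refl = m≤m+n 17 1
total-≥-17 1 0 refl = ≤-refl

-- The values for cycle lengths 3, 4 and 5 are 27, 29 and 26.
total-≥-26 : ∀ d k → d + k ≡ 2 → 26 ≤ total (arcs-all d) (arcs-through d) k
total-≥-26 0 _ refl = m≤m+n 26 1
total-≥-26 1 1 refl = m≤m+n 26 3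
total-≥-26 2 0 refl = ≤-refl

-- Since `total 10 7 3` is 37, the value of C₆, the bound for the lollipop also serves the cycle;
-- this is the tie at n = 6.
total-≥-37 : ∀ d k → d + k ≡ 3 → 37 ≤ total (arcs-all d) (arcs-through d) k
total-≥-37 d k eq = subst (λ j → total 10 7 j ≤ total (arcs-all d) (arcs-through d) k) eq
  (total-lollipop-≤ d k (≤-reflexive (sym eq)))

coreIndex-≥-total : ∀ {n} → 3 ≤ n → (G : SimpleGraph n) → Unicyclic G →
  ∃₂ λ d k → 3 + (d + k) ≡ n × total (arcs-all d) (arcs-through d) k ≤ coreIndex G
coreIndex-≥-total {n} (s≤s _) G uni = shift (coreIndex-lower {G = G} uni zero)
  where
  shift : (∃₂ λ m k → 2 ≤ m × suc m + k ≡ n ×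
            total (suc (triangular (suc m)) + triangular m) (suc (triangular (suc m))) k ≤ coreIndex G) →
          ∃₂ λ d k → 3 + (d + k) ≡ n × total (arcs-all d) (arcs-through d) k ≤ coreIndex G
  shift (suc (suc d) , k , _ , eq , bound) = d , k , eq , bound
  shift (suc zero , _ , s≤s () , _)

coreIndex-lollipop-≤ : ∀ {n} k → 3 + k ≡ n → coreIndex (lollipop n) ≤ total 10 7 k
coreIndex-lollipop-≤ k refl = coreIndex-lollipop k

lollipop-minimal : ∀ {n} → 6 ≤ n → (G : SimpleGraph n) → Unicyclic G → coreIndex (lollipop n) ≤ coreIndex G
lollipop-minimal 6≤n G uni =
  let d , k , eq , bound = coreIndex-≥-total (≤-trans (m≤m+n 3 3) 6≤n) G uni
      3≤d+k              = +-cancelˡ-≤ 3 3 (d + k) (≤-trans 6≤n (≤-reflexive (sym eq)))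
  in ≤-trans (coreIndex-lollipop-≤ (d + k) eq) (≤-trans (total-lollipop-≤ d k 3≤d+k) bound)

cycle-minimal : ∀ {n j c} → n ≡ 3 + j → coreIndex (cycleGraph n) ≤ c →
  (∀ d k → d + k ≡ j → c ≤ total (arcs-all d) (arcs-through d) k) →
  (G : SimpleGraph n) → Unicyclic G → coreIndex (cycleGraph n) ≤ coreIndex G
cycle-minimal {j = j} n≡ upper lower G uni =
  let d , k , eq , bound = coreIndex-≥-total (≤-trans (m≤m+n 3 j) (≤-reflexive (sym n≡))) G uni
  in ≤-trans upper (≤-trans (lower d k (+-cancelˡ-≡ 3 (d + k) j (trans eq n≡))) bound)

theorem4p11 : (n : ℕ) → 4 ≤ n →
    (Unicyclic (lollipop n) × Unicyclic (cycleGraph n))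
    × ((G : SimpleGraph n) → Unicyclic G →
    (7 ≤ n → coreIndex (lollipop n) ≤ coreIndex G)
    × (n ≤ 5 → coreIndex (cycleGraph n) ≤ coreIndex G)
    × (n ≡ 6 → (coreIndex (cycleGraph n) ≤ coreIndex G) × (coreIndex (lollipop n) ≤ coreIndex G)))
theorem4p11 n 4≤n = (lollipop-unicyclic 3≤n , cycle-unicyclic 3≤n) , λ G uni →
    (λ 7≤n → lollipop-minimal (≤-trans (n≤1+n 6) 7≤n) G uni)
  , (λ n≤5 → [ (λ { (s≤s n≤4) → cycle-minimal (≤-antisym n≤4 4≤n) (coreIndex-cycle₄ (≤-antisym n≤4 4≤n)) total-≥-17 G uni })
             , (λ n≡5 → cycle-minimal n≡5 (coreIndex-cycle₅ n≡5) total-≥-26 G uni) ]′ (m≤n⇒m<n∨m≡n n≤5))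
  , (λ n≡6 → cycle-minimal n≡6 (coreIndex-cycle₆ n≡6) total-≥-37 G uni , lollipop-minimal (≤-reflexive (sym n≡6)) G uni)
  where
  3≤n : 3 ≤ n
  3≤n = ≤-trans (n≤1+n 3) 4≤n
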